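{- Let $G$ be a finite graph and let $\mathcal{V}=\{V_1,\ldots,V_n\}$ be a partition of $V(G)$; write $V_I=\bigcup_{i\in I}V_i$. Each of the following conditions is sufficient for $\mathbf{RG}(\mathcal{I}(G),\mathcal{V})$ to be connected: (a) $\tilde\gamma(G[V_I])\ge 2|I|+1$ for all nonempty $I\subseteq[n]$; (b) $i\gamma(G[V_I])\ge|I|+1$ for all nonempty $I\subseteq[n]$.
   Context: $\mathcal{I}(G)$ is the complex of independent sets of $G$. An independent transversal is an independent set of $G$ containing exactly one vertex from each $V_i$. $\mathbf{RG}(\mathcal{I}(G),\mathcal{V})$ is the graph on the independent transversals, two being adjacent if their union is an independent set of size $n+1$. A vertex set $X$ strongly dominates a vertex set $Y$ if every vertex of $Y$ is adjacent to some vertex of $X$. $\tilde\gamma(H)$ is the minimum size of a set strongly dominating $V(H)$; $i\gamma(H)$ is the minimum integer $\ell$ such that every independent set of $H$ is strongly dominated by some vertex set of size at most $\ell$ (these are $\infty$ if no such set/integer exists). -}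

module Defs where

open import Data.Fin using (Fin)
open import Data.Fin.Properties using (any?; all?)
open import Data.Fin.Subset using (Subset; _∈_; _⊆_; _∪_; ∣_∣)
open import Data.Fin.Subset.Properties using (_∈?_; anySubset?; ∣p∣≤n; ∪-comm)
open import Data.Nat using (ℕ; zero; suc; _≤_; _<_; s≤s)
open import Data.Nat.Properties using (_≟_; _≤?_; ≤-refl; ≮⇒≥; m<1+n⇒m<n∨m≡n)
open import Data.Product using (∃; ∃-syntax; ∃!; _×_; _,_; proj₁; proj₂)
open import Data.Sum using (_⊎_; inj₁; inj₂)
open import Function using (case_of_)
open import Level using (0ℓ)
open import Relation.Binary.Construct.Closure.ReflexiveTransitive using (Star)
open import Relation.Binary.Core using (Rel)
import Relation.Binary.Construct.Add.Supremum.NonStrict as AddSup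
import Relation.Binary.Definitions as B
open import Relation.Binary.PropositionalEquality using (_≡_; _≢_; refl; sym; subst)
open import Relation.Nullary using (¬_; Dec; yes; no)
open import Relation.Nullary.Construct.Add.Supremum using (_⁺; [_]; ⊤⁺)
open import Relation.Nullary.Decidable using (_×-dec_; _→-dec_; ¬?; decidable-stable)
open import Relation.Unary using (Pred; Decidable)

ℕ∞ : Set
ℕ∞ = ℕ ⁺

open AddSup _≤_ public using () renaming (_≤⁺_ to _≤∞_)

-- "x is the minimum of { k | P k }", where the minimum of the empty set is ∞.
data IsMinimum (P : Pred ℕ 0ℓ) : ℕ∞ → Set where
  attained : ∀ {ℓ} → P ℓ → (∀ k → P k → ℓ ≤ k) → IsMinimum P [ ℓ ]
  vacuous  : (∀ k → ¬ P k) → IsMinimum P ⊤⁺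

private
  search : {P : Pred ℕ 0ℓ} → Decidable P → (b : ℕ) →
           (∃[ ℓ ] P ℓ × (∀ k → P k → ℓ ≤ k)) ⊎ (∀ k → k < b → ¬ P k)
  search P? zero = inj₂ λ _ ()
  search P? (suc b) with search P? b
  ... | inj₁ found = inj₁ found
  ... | inj₂ none with P? b
  ...   | yes pb = inj₁ (b , pb , λ k pk → ≮⇒≥ λ k<b → none k k<b pk)
  ...   | no ¬pb = inj₂ λ k k<1+b → case m<1+n⇒m<n∨m≡n k<1+b of λ where
                     (inj₁ k<b)  → none k k<b
                     (inj₂ refl) → ¬pb

minimum : {P : Pred ℕ 0ℓ} → Decidable P → (b : ℕ) →
          (∀ k → P k → ∃[ j ] j ≤ b × P j) → ∃ (IsMinimum P)
minimum P? b bounded with search P? (suc b)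
... | inj₁ (ℓ , pℓ , ℓ≤) = [ ℓ ] , attained pℓ ℓ≤
... | inj₂ none = ⊤⁺ , vacuous λ k pk → let (j , j≤b , pj) = bounded k pk in
                                        none j (s≤s j≤b) pj

allSubsets? : ∀ {N} {P : Pred (Subset N) 0ℓ} → Decidable P → Dec (∀ S → P S)
allSubsets? P? with anySubset? (λ S → ¬? (P? S))
... | yes (S , ¬pS) = no λ ∀p → ¬pS (∀p S)
... | no ∄ = yes λ S → decidable-stable (P? S) λ ¬pS → ∄ (S , ¬pS)

-- Simple graphs whose vertices form a subset of an ambient type A.
record Graph (A : Set) : Set₁ where
  infix 4 _~_
  field
    Vertex     : Pred A 0ℓ
    _~_        : Rel A 0ℓ
    ~-irrefl   : ∀ {x} → ¬ (x ~ x)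
    ~-sym      : ∀ {x y} → x ~ y → y ~ x
    ~⇒Vertex   : ∀ {x y} → x ~ y → Vertex x

-- A connected graph is nonempty.
Connected : {A : Set} → Graph A → Set
Connected G = ∃ Vertex × (∀ u v → Vertex u → Vertex v → Star _~_ u v)
  where open Graph G

record FiniteGraph (N : ℕ) : Set₁ where
  field
    graph   : Graph (Fin N)
  open Graph graph public
  field
    vertex? : Decidable Vertex
    _~?_    : B.Decidable _~_

module _ {N : ℕ} where

  induced : (G : FiniteGraph N) {P : Pred (Fin N) 0ℓ} → Decidable P → FiniteGraph N
  induced G {P} P? = record
    { graph = record
      { Vertex   = λ x → Vertex x × P x
      ; _~_      = λ x y → (x ~ y) × P x × P y
      ; ~-irrefl = λ (e , _) → ~-irrefl e
      ; ~-sym    = λ (e , px , py) → ~-sym e , py , px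
      ; ~⇒Vertex = λ (e , px , _) → ~⇒Vertex e , px
      }
    ; vertex? = λ x → vertex? x ×-dec P? x
    ; _~?_    = λ x y → (x ~? y) ×-dec P? x ×-dec P? y
    }
    where open FiniteGraph G

  module _ (H : FiniteGraph N) where
    open FiniteGraph H

    VertexSet : Pred (Subset N) 0ℓ
    VertexSet X = ∀ x → x ∈ X → Vertex x

    Independent : Pred (Subset N) 0ℓ
    Independent S = VertexSet S × (∀ x y → x ∈ S → y ∈ S → ¬ (x ~ y))

    StronglyDominates : Subset N → Pred (Fin N) 0ℓ → Set
    StronglyDominates X Y = ∀ y → Y y → ∃[ x ] x ∈ X × (x ~ y)

    DominatingSize : Pred ℕ 0ℓ
    DominatingSize k = ∃[ X ] VertexSet X × StronglyDominates X Vertex × ∣ X ∣ ≡ k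

    IndependentDominationBound : Pred ℕ 0ℓ
    IndependentDominationBound ℓ =
      ∀ S → Independent S →
      ∃[ X ] VertexSet X × StronglyDominates X (_∈ S) × ∣ X ∣ ≤ ℓ

    vertexSet? : Decidable VertexSet
    vertexSet? X = all? λ x → (x ∈? X) →-dec vertex? x

    independent? : Decidable Independent
    independent? S = vertexSet? S ×-dec
      all? λ x → all? λ y → (x ∈? S) →-dec ((y ∈? S) →-dec ¬? (x ~? y))

    stronglyDominates? : ∀ X {Y} → Decidable Y → Dec (StronglyDominates X Y)
    stronglyDominates? X Y? = all? λ y → Y? y →-dec any? λ x → (x ∈? X) ×-dec (x ~? y)

    dominatingSize? : Decidable DominatingSize
    dominatingSize? k = anySubset? λ X →
      vertexSet? X ×-dec stronglyDominates? X vertex? ×-dec (∣ X ∣ ≟ k)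

    independentDominationBound? : Decidable IndependentDominationBound
    independentDominationBound? ℓ = allSubsets? λ S → independent? S →-dec
      anySubset? λ X →
        vertexSet? X ×-dec stronglyDominates? X (_∈? S) ×-dec (∣ X ∣ ≤? ℓ)

    γ̃-minimum : ∃ (IsMinimum DominatingSize)
    γ̃-minimum = minimum dominatingSize? N
      λ { k d@(X , _ , _ , refl) → k , ∣p∣≤n X , d }

    iγ-minimum : ∃ (IsMinimum IndependentDominationBound)
    iγ-minimum = minimum independentDominationBound? N
      λ k d → N , ≤-refl , λ S ind → let (X , X⊆V , dom , _) = d S ind in
                                     X , X⊆V , dom , ∣p∣≤n X

    γ̃ : ℕ∞
    γ̃ = proj₁ γ̃-minimum

    iγ : ℕ∞
    iγ = proj₁ iγ-minimum

  -- Classes may be empty. The graph induced on an empty class has γ̃ = iγ = 0,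
  -- so a positive lower bound on either invariant excludes this.
  record Partition (W : Pred (Fin N) 0ℓ) (n : ℕ) : Set where
    field
      class    : Fin n → Subset N
      class⊆   : ∀ {i v} → v ∈ class i → W v
      covers   : ∀ {v} → W v → ∃[ i ] v ∈ class i
      disjoint : ∀ {i j v} → v ∈ class i → v ∈ class j → i ≡ j

    ⋃Class : Subset n → Pred (Fin N) 0ℓ
    ⋃Class I v = ∃[ i ] i ∈ I × v ∈ class i

    ⋃Class? : ∀ I → Decidable (⋃Class I)
    ⋃Class? I v = any? λ i → (i ∈? I) ×-dec (v ∈? class i)

    Transversal : Pred (Subset N) 0ℓ
    Transversal S = ∀ i → ∃! _≡_ λ v → v ∈ S × v ∈ class i

  record Complex (W : Pred (Fin N) 0ℓ) : Set₁ where
    field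
      Face        : Pred (Subset N) 0ℓ
      face⊆       : ∀ {S} → Face S → ∀ x → x ∈ S → W x
      down-closed : ∀ {S T} → T ⊆ S → Face S → Face T

  𝓘 : (G : FiniteGraph N) → Complex (FiniteGraph.Vertex G)
  𝓘 G = record
    { Face        = Independent G
    ; face⊆       = proj₁
    ; down-closed = λ T⊆S (S⊆V , ind) →
        (λ x x∈T → S⊆V x (T⊆S x∈T)) ,
        (λ x y x∈T y∈T → ind x y (T⊆S x∈T) (T⊆S y∈T))
    }

  -- S ≢ T is implied by the size condition; it makes irreflexivity immediate.
  RG : ∀ {W n} → Complex W → Partition W n → Graph (Subset N)
  RG {n = n} C 𝓥 = record
    { Vertex   = IT
    ; _~_      = λ S T → IT S × IT T × S ≢ T × Face (S ∪ T) × ∣ S ∪ T ∣ ≡ suc n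
    ; ~-irrefl = λ (_ , _ , S≢S , _) → S≢S refl
    ; ~-sym    = λ {S} {T} (s , t , S≢T , f , c) →
        t , s , (λ T≡S → S≢T (sym T≡S)) ,
        subst (λ U → Face U × ∣ U ∣ ≡ suc n) (∪-comm S T) (f , c)
    ; ~⇒Vertex = proj₁
    }
    where
    open Complex C
    open Partition 𝓥
    IT : Pred (Subset N) 0ℓ
    IT S = Face S × Transversal S

{-# OPTIONS --safe #-}
-- Cochains are taken with coefficients in 𝔽₂, on the independent sets of a graph, and graded by
-- the number of vertices.  Deleting an edge e or exploding it (removing both neighbourhoods of
-- its ends) gives Meshulam's inequality: cocycles of G in degree j + 1 are coboundaries if this
-- holds for G − e in degree j + 1 and for the exploded graph in degree j.  Hence a set Y of
-- vertices that few vertices cannot dominate forces acyclicity in low degrees: explosion costs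
-- two dominating vertices, or one if Y is independent.  Under either hypothesis of the theorem,
-- every G[V_I] with I nonempty is therefore acyclic in all degrees up to |I|.
--
-- An independent set with n + 1 vertices contains no independent transversal or exactly two,
-- and these two are adjacent in RG.  So the indicator A of a component of RG is a cocycle.  It
-- vanishes on each V_J with J ≠ [n], so a descent in the double complex of cochains on the V_J
-- (solve f_J = δ g_J, then pass to f'_K = Σ_{i ∉ K} g_{K ∪ i}) leaves Σ_J f_J(S ∩ V_J) unchanged
-- for every independent transversal S and ends at a constant f_∅(∅) not depending on S.  Hence
-- A is constant.  If V_2, …, V_n had an independent transversal that V_1, …, V_n lacks, the same
-- descent with V_{J ∪ 1} in place of V_J, applied to the indicator of all independent transversals
-- of V_2, …, V_n, would end at 0, since V_1 is nonempty; this gives existence by induction.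
module Submission where

open import Defs
open import Algebra.Bundles using (CommutativeRing)
import Algebra.Properties.CommutativeMonoid.Sum as CMSum
open import Data.Bool using (Bool; true; false; not; _∧_; _xor_; if_then_else_)
open import Data.Bool.Properties using (xor-∧-commutativeRing; xor-identityʳ; xor-same; xor-comm; xor-assoc; ∧-distribˡ-xor; ∧-zeroʳ; ∧-assoc; ∧-comm; ¬-not) renaming (_≟_ to _≟ᵇ_)
open import Data.Fin using (Fin; zero; suc; punchIn)
open import Data.Fin.Properties using (punchInᵢ≢i; suc-injective; _≟_; any?; all?)
open import Data.Fin.Subset using (Subset; ∣_∣; ⊥; ⊤; _∈_; _∪_; Nonempty)
open import Data.Fin.Subset.Properties using (∣p∣≤n; ∣⊥∣≡0; ∉⊥; ∣⊤∣≡n; ∣p∣≡n⇒p≡⊤; ∈⊤; _∈?_; anySubset?; ⊆-antisym; x∈p∪q⁺; x∈p∪q⁻; nonempty?; Empty-unique)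
open import Data.List using (List; []; _∷_; allFin; cartesianProduct; map; _++_)
open import Data.List.Membership.Propositional using () renaming (_∈_ to _∈ˡ_)
open import Data.List.Membership.Propositional.Properties using (∈-allFin; ∈-cartesianProduct⁺; ∈-map⁺; ∈-++⁺ˡ; ∈-++⁺ʳ)
open import Data.List.Relation.Unary.Any using (here; there)
open import Data.Nat using (ℕ; zero; suc; _≤_; s≤s; _<_; _*_; _+_)
import Data.Nat.Properties as ℕ
open import Data.Product using (∃-syntax; _×_; _,_; proj₁; proj₂; ∃; ∃!)
open import Data.Sum using (_⊎_; inj₁; inj₂)
open import Data.Vec using ([]; _∷_; lookup; _[_]≔_; here; there)
open import Data.Vec.Functional using (removeAt)
open import Data.Vec.Properties using (lookup∘update; lookup∘update′; []≔-commutes; []≔-idempotent; []≔-lookup; []=⇒lookup; lookup⇒[]=; ≡-dec)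
open import Function using (_∘_)
open import Function.Definitions using (Injective)
open import Level using (0ℓ)
import Relation.Binary.Construct.Add.Supremum.NonStrict as AddSup
open import Relation.Binary.Construct.Closure.ReflexiveTransitive using (Star; ε; _◅_; _◅◅_)
open import Relation.Binary.Core using (Rel)
import Relation.Binary.Definitions as B
open import Relation.Binary.PropositionalEquality using (_≡_; _≢_; _≗_; refl; sym; trans; cong; cong₂; subst; module ≡-Reasoning)
open import Relation.Nullary using (yes; no; contradiction; ¬_; Dec)
open import Relation.Nullary.Construct.Add.Supremum using ([_])
open import Relation.Nullary.Decidable using (¬?; _×-dec_; _⊎-dec_; does; dec-true; dec-false; map′; _→-dec_; decidable-stable)
open import Relation.Unary using (Pred; Decidable)
open CMSum (CommutativeRing.+-commutativeMonoid xor-∧-commutativeRing)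
  using (sum; sum-cong-≗; sum-replicate-zero; sum-remove; ∑-distrib-+; ∑-comm)
open FiniteGraph

-- Sums over 𝔽₂, indexed by a finite set or by all its subsets.

private variable
  m n N : ℕ

sum-false : (a : Fin n → Bool) → (∀ i → a i ≡ false) → sum a ≡ false
sum-false {n} a a≡0 = trans (sum-cong-≗ {n} a≡0) (sum-replicate-zero n)

sum-split : (p : Fin n) {a b : Fin n → Bool} → b p ≡ false → (∀ v → v ≢ p → a v ≡ b v) →
            sum a ≡ a p xor sum b
sum-split {suc n} p {a} {b} bp a≡b = begin
  sum a                                 ≡⟨ sum-remove {i = p} a ⟩
  a p xor sum (removeAt a p)            ≡⟨ cong (a p xor_) (sum-cong-≗ λ j → a≡b (punchIn p j) (punchInᵢ≢i p j)) ⟩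
  a p xor sum (removeAt b p)            ≡⟨ cong (λ c → a p xor (c xor sum (removeAt b p))) bp ⟨
  a p xor (b p xor sum (removeAt b p))  ≡⟨ cong (a p xor_) (sum-remove {i = p} b) ⟨
  a p xor sum b                         ∎
  where open ≡-Reasoning

sum-single : (p : Fin n) {a : Fin n → Bool} → (∀ v → v ≢ p → a v ≡ false) → sum a ≡ a p
sum-single {n} p {a} h = trans (sum-split p {b = λ _ → false} refl h)
  (trans (cong (a p xor_) (sum-false {n} _ λ _ → refl)) (xor-identityʳ _))

sum-∧ : ∀ b (a : Fin n → Bool) → b ∧ sum a ≡ sum (λ i → b ∧ a i)
sum-∧     true  a = refl
sum-∧ {n} false a = sym (sum-false {n} _ λ _ → refl)

-- Off the diagonal, each entry cancels against its mirror image modulo 2. The induction strips the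
-- first row and the first column, which are equal.
sum-symmetric : (a : Fin n → Fin n → Bool) → (∀ i → a i i ≡ false) → (∀ i j → a i j ≡ a j i) →
                sum (λ i → sum (a i)) ≡ false
sum-symmetric {zero}  a _ _ = refl
sum-symmetric {suc n} a diag symm = begin
  (a zero zero xor r) xor sum (λ i → a (suc i) zero xor sum (a (suc i) ∘ suc))
    ≡⟨ cong₂ _xor_ (cong (_xor r) (diag zero)) (∑-distrib-+ (λ i → a (suc i) zero) _) ⟩
  r xor (sum (λ i → a (suc i) zero) xor sum (λ i → sum (a (suc i) ∘ suc)))
    ≡⟨ cong (r xor_) (cong₂ _xor_ (sum-cong-≗ λ i → symm (suc i) zero)
         (sum-symmetric (λ i j → a (suc i) (suc j)) (diag ∘ suc) λ i j → symm (suc i) (suc j))) ⟩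
  r xor (r xor false)
    ≡⟨ cong (r xor_) (xor-identityʳ r) ⟩
  r xor r
    ≡⟨ xor-same r ⟩
  false ∎
  where
  open ≡-Reasoning
  r = sum (λ j → a zero (suc j))

sumSubsets : (Subset n → Bool) → Bool
sumSubsets {zero}  F = F []
sumSubsets {suc n} F = sumSubsets (F ∘ (true ∷_)) xor sumSubsets (F ∘ (false ∷_))

sumSubsets-cong : {F F′ : Subset n → Bool} → F ≗ F′ → sumSubsets F ≡ sumSubsets F′
sumSubsets-cong {zero}  h = h []
sumSubsets-cong {suc n} h = cong₂ _xor_ (sumSubsets-cong (h ∘ (true ∷_))) (sumSubsets-cong (h ∘ (false ∷_)))

sumSubsets-false : (F : Subset n → Bool) → (∀ J → F J ≡ false) → sumSubsets F ≡ false
sumSubsets-false {zero}  F h = h []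
sumSubsets-false {suc n} F h = cong₂ _xor_ (sumSubsets-false _ (h ∘ (true ∷_))) (sumSubsets-false _ (h ∘ (false ∷_)))

xor-interchange : ∀ a b c d → (a xor b) xor (c xor d) ≡ (a xor c) xor (b xor d)
xor-interchange a b c d = begin
  (a xor b) xor (c xor d)  ≡⟨ xor-assoc a b _ ⟩
  a xor (b xor (c xor d))  ≡⟨ cong (a xor_) (xor-assoc b c d) ⟨
  a xor ((b xor c) xor d)  ≡⟨ cong (λ e → a xor (e xor d)) (xor-comm b c) ⟩
  a xor ((c xor b) xor d)  ≡⟨ cong (a xor_) (xor-assoc c b d) ⟩
  a xor (c xor (b xor d))  ≡⟨ xor-assoc a c _ ⟨
  (a xor c) xor (b xor d)  ∎
  where open ≡-Reasoning

sumSubsets-sum : ∀ {m} (a : Subset n → Fin m → Bool) →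
                 sumSubsets (λ J → sum (a J)) ≡ sum (λ i → sumSubsets (λ J → a J i))
sumSubsets-sum {zero}  a = refl
sumSubsets-sum {suc n} a = trans
  (cong₂ _xor_ (sumSubsets-sum (a ∘ (true ∷_))) (sumSubsets-sum (a ∘ (false ∷_))))
  (sym (∑-distrib-+ (λ i → sumSubsets (λ J → a (true ∷ J) i)) _))

-- Reindexing by `J = K + i`, a bijection from the sets without `i` to the sets with `i`.
sumSubsets-shift : (i : Fin n) (a : Subset n → Bool) →
  sumSubsets (λ J → lookup J i ∧ a J) ≡ sumSubsets (λ K → not (lookup K i) ∧ a (K [ i ]≔ true))
sumSubsets-shift {suc n} zero a = xor-comm (sumSubsets (a ∘ (true ∷_))) (sumSubsets {n} λ _ → false)
sumSubsets-shift (suc i) a =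
  cong₂ _xor_ (sumSubsets-shift i (a ∘ (true ∷_))) (sumSubsets-shift i (a ∘ (false ∷_)))

sumSubsets-only-⊥ : (F : Subset n → Bool) → (∀ J → ∣ J ∣ ≢ 0 → F J ≡ false) → sumSubsets F ≡ F ⊥
sumSubsets-only-⊥ {zero}  F h = refl
sumSubsets-only-⊥ {suc n} F h =
  cong₂ _xor_ (sumSubsets-false _ λ J → h (true ∷ J) λ ()) (sumSubsets-only-⊥ (F ∘ (false ∷_)) (h ∘ (false ∷_)))

sumSubsets-only-⊤ : (F : Subset n → Bool) → (∀ J → ∣ J ∣ ≢ n → F J ≡ false) → sumSubsets F ≡ F ⊤
sumSubsets-only-⊤ {zero}  F h = refl
sumSubsets-only-⊤ {suc n} F h = trans
  (cong₂ _xor_ (sumSubsets-only-⊤ (F ∘ (true ∷_)) λ J J≢ → h (true ∷ J) (J≢ ∘ ℕ.suc-injective))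
    (sumSubsets-false _ λ J → h (false ∷ J) λ e → contradiction (subst (_≤ n) e (∣p∣≤n J)) ℕ.1+n≰n))
  (xor-identityʳ _)

-- Cardinality under insertion and deletion.

∉⇒false : {σ : Subset N} {v : Fin N} → ¬ v ∈ σ → lookup σ v ≡ false
∉⇒false {σ = σ} {v} v∉σ = ¬-not (v∉σ ∘ lookup⇒[]= v σ)

∣insert∣ : (σ : Subset n) (v : Fin n) → lookup σ v ≡ false → ∣ σ [ v ]≔ true ∣ ≡ suc ∣ σ ∣
∣insert∣ (false ∷ σ) zero    _   = refl
∣insert∣ (true ∷ σ)  (suc v) v∉σ = cong suc (∣insert∣ σ v v∉σ)
∣insert∣ (false ∷ σ) (suc v) v∉σ = ∣insert∣ σ v v∉σ

∣insert∣≤ : (σ : Subset n) (v : Fin n) → ∣ σ [ v ]≔ true ∣ ≤ suc ∣ σ ∣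
∣insert∣≤ (false ∷ σ) zero    = ℕ.≤-refl
∣insert∣≤ (true ∷ σ)  zero    = ℕ.n≤1+n _
∣insert∣≤ (true ∷ σ)  (suc v) = s≤s (∣insert∣≤ σ v)
∣insert∣≤ (false ∷ σ) (suc v) = ∣insert∣≤ σ v

∣delete∣ : (σ : Subset n) (v : Fin n) → lookup σ v ≡ true → suc ∣ σ [ v ]≔ false ∣ ≡ ∣ σ ∣
∣delete∣ (true ∷ σ)  zero    _   = refl
∣delete∣ (true ∷ σ)  (suc v) v∈σ = cong suc (∣delete∣ σ v v∈σ)
∣delete∣ (false ∷ σ) (suc v) v∈σ = ∣delete∣ σ v v∈σ

-- Cochains, the coboundary and acyclicity.

Cochain : ℕ → Set
Cochain N = Subset N → Bool

δ : Cochain N → Cochain N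
δ f σ = sum λ v → lookup σ v ∧ f (σ [ v ]≔ false)

∧-congʳ-true : ∀ b {c d} → (b ≡ true → c ≡ d) → b ∧ c ≡ b ∧ d
∧-congʳ-true true  h = h refl
∧-congʳ-true false h = refl

δ-cong : (f g : Cochain N) (σ : Subset N) →
         (∀ v → lookup σ v ≡ true → f (σ [ v ]≔ false) ≡ g (σ [ v ]≔ false)) → δ f σ ≡ δ g σ
δ-cong f g σ h = sum-cong-≗ λ v → ∧-congʳ-true (lookup σ v) (h v)

δ-xor : (f g : Cochain N) (σ : Subset N) → δ (λ μ → f μ xor g μ) σ ≡ δ f σ xor δ g σ
δ-xor f g σ = trans
  (sum-cong-≗ λ v → ∧-distribˡ-xor (lookup σ v) (f (σ [ v ]≔ false)) (g (σ [ v ]≔ false)))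
  (∑-distrib-+ (λ v → lookup σ v ∧ f (σ [ v ]≔ false)) _)

δ-⊥ : (f : Cochain N) → ∀ σ → (∀ v → lookup σ v ≡ false) → δ f σ ≡ false
δ-⊥ f σ h = sum-false _ λ v → cong (_∧ f (σ [ v ]≔ false)) (h v)

insert-delete : (σ : Subset n) (v : Fin n) {b : Bool} → lookup σ v ≡ b → σ [ v ]≔ not b [ v ]≔ b ≡ σ
insert-delete σ v refl = trans ([]≔-idempotent σ v) ([]≔-lookup σ v)

-- Among the facets of `σ + p`, the one omitting `p` is `σ`; all others have the form `(σ - v) + p`
-- and add up to the coboundary at `σ` of a shifted cochain.
δ-insert : (f : Cochain N) (p : Fin N) (σ : Subset N) → lookup σ p ≡ false →
           δ f (σ [ p ]≔ true) ≡ f σ xor δ (λ μ → f (μ [ p ]≔ true)) σ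
δ-insert f p σ p∉σ = trans
  (sum-split p {a = λ v → lookup (σ [ p ]≔ true) v ∧ f (σ [ p ]≔ true [ v ]≔ false)}
    (cong (_∧ f (σ [ p ]≔ false [ p ]≔ true)) p∉σ)
    λ v v≢p → cong₂ _∧_ (lookup∘update′ v≢p σ true) (cong f ([]≔-commutes σ p v (v≢p ∘ sym))))
  (cong (_xor δ (λ μ → f (μ [ p ]≔ true)) σ)
    (cong₂ _∧_ (lookup∘update p σ true) (cong f (insert-delete σ p p∉σ))))

-- For a simplicial complex this is the vanishing of reduced cohomology in dimension `j - 1`, as `j`
-- counts vertices. Cochains live on all subsets; passing to a complex means testing equations on
-- its faces only.
Acyclic : Pred (Subset N) 0ℓ → ℕ → Set
Acyclic Face j = ∀ f → (∀ τ → Face τ → ∣ τ ∣ ≡ suc j → δ f τ ≡ false) →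
                 ∃[ g ] ∀ σ → Face σ → ∣ σ ∣ ≡ j → f σ ≡ δ g σ

Acyclic-resp : {P Q : Pred (Subset N) 0ℓ} → (∀ {σ} → P σ → Q σ) → (∀ {σ} → Q σ → P σ) →
               ∀ {j} → Acyclic P j → Acyclic Q j
Acyclic-resp P⇒Q Q⇒P acyc f cocycle =
  let (g , f≡δg) = acyc f λ τ pτ → cocycle τ (P⇒Q pτ) in g , λ σ qσ → f≡δg σ (Q⇒P qσ)

-- Membership and independence after deleting or inserting a vertex.

∈-delete⁻ : {σ : Subset N} {u v : Fin N} → u ∈ σ [ v ]≔ false → u ≢ v × u ∈ σ
∈-delete⁻ {σ = σ} {u} {v} u∈ = u≢v , lookup⇒[]= u σ (trans (sym (lookup∘update′ u≢v σ false)) ([]=⇒lookup u∈))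
  where
  u≢v : u ≢ v
  u≢v refl = contradiction (trans (sym (lookup∘update u σ false)) ([]=⇒lookup u∈)) λ ()

∈-delete⁺ : {σ : Subset N} {u v : Fin N} → u ≢ v → u ∈ σ → u ∈ σ [ v ]≔ false
∈-delete⁺ {σ = σ} {u} u≢v u∈ = lookup⇒[]= u _ (trans (lookup∘update′ u≢v σ false) ([]=⇒lookup u∈))

∈-insert⁻ : {σ : Subset N} {u v : Fin N} → u ∈ σ [ v ]≔ true → u ≡ v ⊎ u ∈ σ
∈-insert⁻ {σ = σ} {u} {v} u∈ with u ≟ v
... | yes u≡v = inj₁ u≡v
... | no u≢v  = inj₂ (lookup⇒[]= u σ (trans (sym (lookup∘update′ u≢v σ true)) ([]=⇒lookup u∈)))

∈-insert : (σ : Subset N) (v : Fin N) → v ∈ σ [ v ]≔ true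
∈-insert σ v = lookup⇒[]= v _ (lookup∘update v σ true)

∈-insert⁺ : {σ : Subset N} {u : Fin N} (v : Fin N) → u ∈ σ → u ∈ σ [ v ]≔ true
∈-insert⁺ {σ = σ} {u} v u∈ with u ≟ v
... | yes refl = ∈-insert σ v
... | no u≢v   = lookup⇒[]= u _ (trans (lookup∘update′ u≢v σ true) ([]=⇒lookup u∈))

Independent-insert : (G : FiniteGraph N) (v : Fin N) {σ : Subset N} → Vertex G v →
  (∀ u → u ∈ σ → ¬ _~_ G v u) → Independent G σ → Independent G (σ [ v ]≔ true)
Independent-insert G v {σ} v∈V v≁σ (σ⊆V , ind) = ⊆V , ind′
  where
  ⊆V : VertexSet G (σ [ v ]≔ true)
  ⊆V u u∈ with ∈-insert⁻ u∈
  ... | inj₁ refl = v∈V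
  ... | inj₂ u∈σ  = σ⊆V u u∈σ
  ind′ : ∀ a b → a ∈ σ [ v ]≔ true → b ∈ σ [ v ]≔ true → ¬ _~_ G a b
  ind′ a b a∈ b∈ with ∈-insert⁻ a∈ | ∈-insert⁻ b∈
  ... | inj₁ refl | inj₁ refl = ~-irrefl G
  ... | inj₁ refl | inj₂ b∈σ  = v≁σ b b∈σ
  ... | inj₂ a∈σ  | inj₁ refl = v≁σ a a∈σ ∘ ~-sym G
  ... | inj₂ a∈σ  | inj₂ b∈σ  = ind a b a∈σ b∈σ

-- Base cases of acyclicity: cones and degree zero.

isolated⇒Acyclic : (G : FiniteGraph N) (p : Fin N) → Vertex G p → (∀ u → ¬ _~_ G p u) →
                   ∀ j → Acyclic (Independent G) j
isolated⇒Acyclic {N} G p p∈V p-isolated j f cocycle = g , f≡δg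
  where
  -- An isolated vertex can be added to every independent set, so the complex is a cone with apex
  -- `p`, and `g` is its contracting homotopy applied to `f`.
  g : Cochain N
  g μ = not (lookup μ p) ∧ f (μ [ p ]≔ true)

  f≡δg : ∀ σ → Independent G σ → ∣ σ ∣ ≡ j → f σ ≡ δ g σ
  f≡δg σ ind ∣σ∣≡j with lookup σ p in σp
  -- Deleting a vertex other than `p` leaves `p` in the set, where `g` vanishes; only the term for
  -- `p` survives.
  ... | true = sym (trans
    (sum-single p λ v v≢p → trans
      (cong (λ b → lookup σ v ∧ (not b ∧ f (σ [ v ]≔ false [ p ]≔ true)))
        (trans (lookup∘update′ (v≢p ∘ sym) σ false) σp))
      (∧-zeroʳ (lookup σ v)))
    (cong₂ _∧_ σp (cong₂ (λ b μ → not b ∧ f μ) (lookup∘update p σ false) (insert-delete σ p σp))))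
  ... | false = begin
    f σ                                       ≡⟨ xor-identityʳ (f σ) ⟨
    f σ xor false                             ≡⟨ cong (f σ xor_) (cocycle (σ [ p ]≔ true)
                                                   (Independent-insert G p p∈V (λ u _ → p-isolated u) ind)
                                                   (trans (∣insert∣ σ p σp) (cong suc ∣σ∣≡j))) ⟨
    f σ xor δ f (σ [ p ]≔ true)               ≡⟨ cong (f σ xor_) (δ-insert f p σ σp) ⟩
    f σ xor (f σ xor δ f₊ σ)                  ≡⟨ xor-assoc (f σ) (f σ) _ ⟨
    (f σ xor f σ) xor δ f₊ σ                  ≡⟨ cong (_xor δ f₊ σ) (xor-same (f σ)) ⟩
    δ f₊ σ                                    ≡⟨ δ-cong f₊ g σ (λ v v∈σ → cong (λ b → not b ∧ f₊ (σ [ v ]≔ false))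
                                                   (sym (trans (lookup∘update′ (p≢ v v∈σ) σ false) σp))) ⟩
    δ g σ ∎
    where
    open ≡-Reasoning
    f₊ : Cochain N
    f₊ μ = f (μ [ p ]≔ true)
    p≢ : ∀ v → lookup σ v ≡ true → p ≢ v
    p≢ v v∈σ refl = contradiction (trans (sym v∈σ) σp) λ ()

-- Every coboundary vanishes on the empty set, the only set of size 0, so `f` must vanish there. The
-- cocycle condition at `{p}` says exactly this, as the empty set is its single facet.
nonempty⇒Acyclic₀ : (G : FiniteGraph N) (p : Fin N) → Vertex G p → Acyclic (Independent G) 0
nonempty⇒Acyclic₀ G p p∈V f cocycle = (λ _ → false) , λ σ ind ∣σ∣≡0 →
  let σ∅ = λ v → ¬-not λ v∈σ → contradiction (trans (∣delete∣ σ v v∈σ) ∣σ∣≡0) λ ()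
      open ≡-Reasoning
  in begin
  f σ                                            ≡⟨ xor-identityʳ (f σ) ⟨
  f σ xor false                                  ≡⟨ cong (f σ xor_) (δ-⊥ (λ μ → f (μ [ p ]≔ true)) σ σ∅) ⟨
  f σ xor δ (λ μ → f (μ [ p ]≔ true)) σ          ≡⟨ δ-insert f p σ (σ∅ p) ⟨
  δ f (σ [ p ]≔ true)                            ≡⟨ cocycle (σ [ p ]≔ true)
                                                      (Independent-insert G p p∈V
                                                        (λ u u∈σ → contradiction (trans (sym ([]=⇒lookup u∈σ)) (σ∅ u)) λ ()) ind)
                                                      (trans (∣insert∣ σ p (σ∅ p)) (cong suc ∣σ∣≡0)) ⟩
  false                                          ≡⟨ δ-⊥ (λ _ → false) σ σ∅ ⟨
  δ (λ _ → false) σ                              ∎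

-- Deleting and exploding an edge.

module _ (G : FiniteGraph N) (x y : Fin N) where

  IsEdge : Fin N → Fin N → Set
  IsEdge u v = (u ≡ x × v ≡ y) ⊎ (u ≡ y × v ≡ x)

  deleteEdge : FiniteGraph N
  deleteEdge = record
    { graph = record
      { Vertex   = Vertex G
      ; _~_      = λ u v → _~_ G u v × ¬ IsEdge u v
      ; ~-irrefl = ~-irrefl G ∘ proj₁
      ; ~-sym    = λ (u~v , ¬e) → ~-sym G u~v , λ { (inj₁ (refl , refl)) → ¬e (inj₂ (refl , refl))
                                                  ; (inj₂ (refl , refl)) → ¬e (inj₁ (refl , refl)) }
      ; ~⇒Vertex = ~⇒Vertex G ∘ proj₁
      }
    ; vertex? = vertex? G
    ; _~?_    = λ u v → _~?_ G u v ×-dec ¬? ((u ≟ x ×-dec v ≟ y) ⊎-dec (u ≟ y ×-dec v ≟ x))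
    }

  Far : Fin N → Set
  Far v = ¬ _~_ G x v × ¬ _~_ G y v

  -- For an edge `x y` the ends are neighbours of each other, so they disappear together with both
  -- neighbourhoods.
  explodeEdge : FiniteGraph N
  explodeEdge = induced G {P = Far} λ v → ¬? (_~?_ G x v) ×-dec ¬? (_~?_ G y v)

  Independent-deleteEdge : ∀ {σ} → Independent G σ → Independent deleteEdge σ
  Independent-deleteEdge (σ⊆V , ind) = σ⊆V , λ a b a∈ b∈ (a~b , _) → ind a b a∈ b∈ a~b

  -- f extends by zero to a cochain on the independent sets of G − e; its coboundary there is
  -- a(ρ) = f(ρ + x) + f(ρ + y) on the sets ρ + x + y, and a is a cocycle of the exploded graph.
  -- Writing a = δ b, the value b(μ) on the sets μ + x + y turns the extension into a cocycle F.
  edge⇒Acyclic : _~_ G x y → ∀ j → Acyclic (Independent deleteEdge) (suc j) →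
                 Acyclic (Independent explodeEdge) j → Acyclic (Independent G) (suc j)
  edge⇒Acyclic x~y j acyc-del acyc-exp f cocycle = g , λ σ ind ∣σ∣ →
      trans (sym (F-outside σ (both-false ind))) (F≡δg σ (Independent-deleteEdge ind) ∣σ∣)
    where
    open ≡-Reasoning

    f[_] : Fin N → Cochain N
    f[ v ] μ = f (μ [ v ]≔ true)

    x≢y : x ≢ y
    x≢y refl = ~-irrefl G x~y

    far⇒∉ : ∀ {ρ} → Independent explodeEdge ρ → lookup ρ x ≡ false × lookup ρ y ≡ false
    far⇒∉ (ρ⊆V , _) = ∉⇒false (λ x∈ → proj₂ (proj₂ (ρ⊆V x x∈)) (~-sym G x~y)) ,
                      ∉⇒false (λ y∈ → proj₁ (proj₂ (ρ⊆V y y∈)) x~y)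

    explode⇒Independent : ∀ {ρ} → Independent explodeEdge ρ → Independent G ρ
    explode⇒Independent (ρ⊆V , ind) = (λ v v∈ → proj₁ (ρ⊆V v v∈)) ,
      λ u v u∈ v∈ u~v → ind u v u∈ v∈ (u~v , proj₂ (ρ⊆V u u∈) , proj₂ (ρ⊆V v v∈))

    δf[_] : ∀ v {ρ} → lookup ρ v ≡ false → Independent G (ρ [ v ]≔ true) → ∣ ρ ∣ ≡ suc j →
            f ρ xor δ f[ v ] ρ ≡ false
    δf[ v ] {ρ} v∉ρ ind ∣ρ∣ = trans (sym (δ-insert f v ρ v∉ρ))
      (cocycle (ρ [ v ]≔ true) ind (trans (∣insert∣ ρ v v∉ρ) (cong suc ∣ρ∣)))

    a : Cochain N
    a μ = f[ x ] μ xor f[ y ] μ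

    a-cocycle : ∀ ρ → Independent explodeEdge ρ → ∣ ρ ∣ ≡ suc j → δ a ρ ≡ false
    a-cocycle ρ ind ∣ρ∣ = begin
      δ a ρ                                            ≡⟨ δ-xor f[ x ] f[ y ] ρ ⟩
      -- Adding `f ρ` twice changes nothing and completes the two terms to the cocycle conditions at
      -- `ρ + x` and `ρ + y`. Both sets are independent because the vertices of `ρ` are far from
      -- both ends.
      δ f[ x ] ρ xor δ f[ y ] ρ                        ≡⟨ cong (λ b → (b xor δ f[ x ] ρ) xor δ f[ y ] ρ) (xor-same (f ρ)) ⟨
      ((f ρ xor f ρ) xor δ f[ x ] ρ) xor δ f[ y ] ρ    ≡⟨ xor-assoc (f ρ xor f ρ) _ _ ⟩
      (f ρ xor f ρ) xor (δ f[ x ] ρ xor δ f[ y ] ρ)    ≡⟨ xor-interchange (f ρ) (f ρ) _ _ ⟩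
      (f ρ xor δ f[ x ] ρ) xor (f ρ xor δ f[ y ] ρ)    ≡⟨ cong₂ _xor_
        (δf[ x ] (proj₁ (far⇒∉ ind)) (Independent-insert G x (~⇒Vertex G x~y)
          (λ u u∈ → proj₁ (proj₂ (proj₁ ind u u∈))) (explode⇒Independent ind)) ∣ρ∣)
        (δf[ y ] (proj₂ (far⇒∉ ind)) (Independent-insert G y (~⇒Vertex G (~-sym G x~y))
          (λ u u∈ → proj₂ (proj₂ (proj₁ ind u u∈))) (explode⇒Independent ind)) ∣ρ∣) ⟩
      false                                            ∎

    b : Cochain N
    b = proj₁ (acyc-exp a a-cocycle)

    a≡δb : ∀ σ → Independent explodeEdge σ → ∣ σ ∣ ≡ j → a σ ≡ δ b σ
    a≡δb = proj₂ (acyc-exp a a-cocycle)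

    both : Subset N → Bool
    both σ = lookup σ x ∧ lookup σ y

    F : Cochain N
    F σ = if both σ then b (σ [ x ]≔ false [ y ]≔ false) else f σ

    F-outside : ∀ σ → both σ ≡ false → F σ ≡ f σ
    F-outside σ e = cong (if_then b (σ [ x ]≔ false [ y ]≔ false) else f σ) e

    both-false : ∀ {σ} → Independent G σ → both σ ≡ false
    both-false {σ} (_ , ind) with lookup σ x in σx | lookup σ y in σy
    ... | true  | true  = contradiction x~y (ind x y (lookup⇒[]= x σ σx) (lookup⇒[]= y σ σy))
    ... | true  | false = refl
    ... | false | _     = refl

    F-inside : ∀ μ → lookup μ x ≡ false → lookup μ y ≡ false → F (μ [ x ]≔ true [ y ]≔ true) ≡ b μ
    F-inside μ x∉ y∉ = trans
      (cong (if_then b (μ [ x ]≔ true [ y ]≔ true [ x ]≔ false [ y ]≔ false) else f (μ [ x ]≔ true [ y ]≔ true))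
        (cong₂ _∧_ (trans (lookup∘update′ x≢y (μ [ x ]≔ true) true) (lookup∘update x μ true))
                   (lookup∘update y (μ [ x ]≔ true) true)))
      (cong b (begin
        μ [ x ]≔ true [ y ]≔ true [ x ]≔ false [ y ]≔ false
          ≡⟨ cong (_[ y ]≔ false) ([]≔-commutes (μ [ x ]≔ true) y x (x≢y ∘ sym)) ⟩
        μ [ x ]≔ true [ x ]≔ false [ y ]≔ true [ y ]≔ false
          ≡⟨ cong (λ ν → ν [ y ]≔ true [ y ]≔ false) (insert-delete μ x x∉) ⟩
        μ [ y ]≔ true [ y ]≔ false
          ≡⟨ insert-delete μ y y∉ ⟩
        μ ∎))

    F-cocycle-inside : ∀ ρ → lookup ρ x ≡ false → lookup ρ y ≡ false → Independent explodeEdge ρ → ∣ ρ ∣ ≡ j →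
                       δ F (ρ [ x ]≔ true [ y ]≔ true) ≡ false
    F-cocycle-inside ρ x∉ y∉ ind ∣ρ∣ = begin
      δ F (ρ [ x ]≔ true [ y ]≔ true)
        -- Expanding along `y` and then along `x` separates the facets `ρ + x` and `ρ + y`, where
        -- `F` is `f`, from those containing both ends, where `F` is given by `b`.
        ≡⟨ δ-insert F y (ρ [ x ]≔ true) (trans (lookup∘update′ (x≢y ∘ sym) ρ true) y∉) ⟩
      F (ρ [ x ]≔ true) xor δ (λ μ → F (μ [ y ]≔ true)) (ρ [ x ]≔ true)
        ≡⟨ cong₂ _xor_ (F-outside (ρ [ x ]≔ true) (trans (cong (lookup (ρ [ x ]≔ true) x ∧_)
             (trans (lookup∘update′ (x≢y ∘ sym) ρ true) y∉)) (∧-zeroʳ _)))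
             (δ-insert (λ μ → F (μ [ y ]≔ true)) x ρ x∉) ⟩
      f[ x ] ρ xor (F (ρ [ y ]≔ true) xor δ (λ μ → F (μ [ x ]≔ true [ y ]≔ true)) ρ)
        ≡⟨ cong (f[ x ] ρ xor_) (cong₂ _xor_
             (F-outside (ρ [ y ]≔ true) (cong (_∧ lookup (ρ [ y ]≔ true) y) (trans (lookup∘update′ x≢y ρ true) x∉)))
             (δ-cong (λ μ → F (μ [ x ]≔ true [ y ]≔ true)) b ρ λ v v∈ρ → F-inside (ρ [ v ]≔ false)
               (trans (lookup∘update′ (∉≢∈ x∉ v∈ρ) ρ false) x∉)
               (trans (lookup∘update′ (∉≢∈ y∉ v∈ρ) ρ false) y∉))) ⟩
      f[ x ] ρ xor (f[ y ] ρ xor δ b ρ)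
        ≡⟨ xor-assoc (f[ x ] ρ) _ _ ⟨
      a ρ xor δ b ρ
        ≡⟨ cong (a ρ xor_) (a≡δb ρ ind ∣ρ∣) ⟨
      a ρ xor a ρ
        ≡⟨ xor-same (a ρ) ⟩
      false ∎
      where
      ∉≢∈ : ∀ {u v} → lookup ρ u ≡ false → lookup ρ v ≡ true → u ≢ v
      ∉≢∈ u∉ v∈ refl = contradiction (trans (sym v∈) u∉) λ ()

    -- Without both ends, `τ` is independent in `G` itself and no facet of it contains both ends, so
    -- the condition on `F` is the one on `f`.
    F-cocycle-outside : ∀ τ → Independent deleteEdge τ → both τ ≡ false → ∣ τ ∣ ≡ suc (suc j) → δ F τ ≡ false
    F-cocycle-outside τ (τ⊆V , ind) ¬both ∣τ∣ = trans
      (δ-cong F f τ λ v _ → F-outside (τ [ v ]≔ false) (∉⇒both (τ [ v ]≔ false) λ (x∈ , y∈) →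
        ¬xy (proj₂ (∈-delete⁻ {σ = τ} x∈) , proj₂ (∈-delete⁻ {σ = τ} y∈))))
      (cocycle τ (τ⊆V , λ u v u∈ v∈ u~v → ind u v u∈ v∈ (u~v , λ
        { (inj₁ (refl , refl)) → ¬xy (u∈ , v∈) ; (inj₂ (refl , refl)) → ¬xy (v∈ , u∈) })) ∣τ∣)
      where
      ¬xy : ¬ (x ∈ τ × y ∈ τ)
      ¬xy (x∈ , y∈) = contradiction (trans (sym ¬both) (cong₂ _∧_ ([]=⇒lookup x∈) ([]=⇒lookup y∈))) λ ()
      ∉⇒both : ∀ σ → ¬ (x ∈ σ × y ∈ σ) → both σ ≡ false
      ∉⇒both σ h with lookup σ x in σx | lookup σ y in σy
      ... | true  | true  = contradiction (lookup⇒[]= x σ σx , lookup⇒[]= y σ σy) h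
      ... | true  | false = refl
      ... | false | _     = refl

    F-cocycle : ∀ τ → Independent deleteEdge τ → ∣ τ ∣ ≡ suc (suc j) → δ F τ ≡ false
    F-cocycle τ ind@(τ⊆V , τ-ind) ∣τ∣ with lookup τ x in τx | lookup τ y in τy
    ... | false | _     = F-cocycle-outside τ ind (cong (_∧ lookup τ y) τx) ∣τ∣
    ... | true  | false = F-cocycle-outside τ ind (cong₂ _∧_ τx τy) ∣τ∣
    ... | true  | true  = subst (λ σ → δ F σ ≡ false) ρ+xy≡τ
      (F-cocycle-inside ρ ρx (lookup∘update y (τ [ x ]≔ false) false) (ρ⊆V , ρ-ind)
        (ℕ.suc-injective (ℕ.suc-injective (begin
          suc (suc ∣ ρ ∣)            ≡⟨ cong suc (∣delete∣ (τ [ x ]≔ false) y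
                                          (trans (lookup∘update′ (x≢y ∘ sym) τ false) τy)) ⟩
          suc ∣ τ [ x ]≔ false ∣     ≡⟨ ∣delete∣ τ x τx ⟩
          ∣ τ ∣                      ≡⟨ ∣τ∣ ⟩
          suc (suc j)                ∎))))
      where
      ρ : Subset N
      ρ = τ [ x ]≔ false [ y ]≔ false
      ρx : lookup ρ x ≡ false
      ρx = trans (lookup∘update′ x≢y (τ [ x ]≔ false) false) (lookup∘update x τ false)
      ρ+xy≡τ : ρ [ x ]≔ true [ y ]≔ true ≡ τ
      ρ+xy≡τ = begin
        τ [ x ]≔ false [ y ]≔ false [ x ]≔ true [ y ]≔ true
          ≡⟨ cong (_[ y ]≔ true) ([]≔-commutes (τ [ x ]≔ false) y x (x≢y ∘ sym)) ⟩
        τ [ x ]≔ false [ x ]≔ true [ y ]≔ false [ y ]≔ true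
          ≡⟨ cong (λ ν → ν [ y ]≔ false [ y ]≔ true) (insert-delete τ x τx) ⟩
        τ [ y ]≔ false [ y ]≔ true
          ≡⟨ insert-delete τ y τy ⟩
        τ ∎
      ∈ρ⁻ : ∀ {v} → v ∈ ρ → v ∈ τ × v ≢ x × v ≢ y
      ∈ρ⁻ v∈ρ = let (v≢y , v∈) = ∈-delete⁻ {σ = τ [ x ]≔ false} v∈ρ
                    (v≢x , v∈τ) = ∈-delete⁻ {σ = τ} v∈
                in v∈τ , v≢x , v≢y
      -- The only edge of `G` that `τ` can span is `x y`, and `τ` contains both ends; so its other
      -- vertices are adjacent to neither end.
      ρ⊆V : VertexSet explodeEdge ρ
      ρ⊆V v v∈ρ = let (v∈τ , v≢x , v≢y) = ∈ρ⁻ v∈ρ in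
        τ⊆V v v∈τ ,
        (λ x~v → τ-ind x v (lookup⇒[]= x τ τx) v∈τ
          (x~v , λ { (inj₁ (_ , v≡y)) → v≢y v≡y ; (inj₂ (_ , v≡x)) → v≢x v≡x })) ,
        (λ y~v → τ-ind y v (lookup⇒[]= y τ τy) v∈τ
          (y~v , λ { (inj₁ (_ , v≡y)) → v≢y v≡y ; (inj₂ (_ , v≡x)) → v≢x v≡x }))
      ρ-ind : ∀ u v → u ∈ ρ → v ∈ ρ → ¬ _~_ explodeEdge u v
      ρ-ind u v u∈ρ v∈ρ (u~v , _) = let (u∈τ , u≢x , u≢y) = ∈ρ⁻ u∈ρ in
        τ-ind u v u∈τ (proj₁ (∈ρ⁻ v∈ρ))
          (u~v , λ { (inj₁ (u≡x , _)) → u≢x u≡x ; (inj₂ (u≡y , _)) → u≢y u≡y })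

    g : Cochain N
    g = proj₁ (acyc-del F F-cocycle)

    F≡δg : ∀ σ → Independent deleteEdge σ → ∣ σ ∣ ≡ suc j → F σ ≡ δ g σ
    F≡δg = proj₂ (acyc-del F F-cocycle)

-- From domination to acyclicity.

∃-undominated : (G : FiniteGraph N) {Y : Pred (Fin N) 0ℓ} → Decidable Y → ∀ {m} →
                (∀ X → VertexSet G X → StronglyDominates G X Y → m < ∣ X ∣) → ∃[ y ] Y y
∃-undominated {N} G Y? hard with any? Y?
... | yes y∈Y = y∈Y
-- An empty `Y` would be dominated by the empty set, whose size 0 is not above `m`.
... | no Y∅   = contradiction
  (subst (_ <_) (∣⊥∣≡0 N) (hard ⊥ (λ _ x∈⊥ → contradiction x∈⊥ ∉⊥) λ y y∈Y → contradiction (y , y∈Y) Y∅)) λ ()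

-- The number of vertices needed to dominate the part of Y that is lost when an edge x y
-- with x ∈ Y is exploded: x and y in general, y alone if Y is independent.
data Cost (G : FiniteGraph N) (Y : Pred (Fin N) 0ℓ) : ℕ → Set where
  both-ends : Cost G Y 2
  far-end   : (∀ u v → Y u → Y v → ¬ _~_ G u v) → Cost G Y 1

-- Recursion on the list E, which contains every edge meeting Y, replaces induction on the number of edges.
undominated⇒Acyclic : ∀ {c} (E : List (Fin N × Fin N)) (G : FiniteGraph N) {Y : Pred (Fin N) 0ℓ} → Decidable Y →
  (∀ y → Y y → Vertex G y) → (∀ u v → Y u → _~_ G u v → (u , v) ∈ˡ E) → Cost G Y c →
  ∀ k → (∀ X → VertexSet G X → StronglyDominates G X Y → c * k < ∣ X ∣) →
  Acyclic (Independent G) k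
undominated⇒Acyclic E G Y? Y⊆V edges cost zero hard =
  let (y , y∈Y) = ∃-undominated G Y? hard in nonempty⇒Acyclic₀ G y (Y⊆V y y∈Y)
-- No pair is left in `E`, so no edge meets `Y` and any vertex of `Y` is isolated.
undominated⇒Acyclic [] G Y? Y⊆V edges cost (suc k) hard =
  let (y , y∈Y) = ∃-undominated G Y? hard in
  isolated⇒Acyclic G y (Y⊆V y y∈Y) (λ u y~u → contradiction (edges y u y∈Y y~u) λ ()) (suc k)
undominated⇒Acyclic {N} {c} ((x , y) ∷ E) G {Y} Y? Y⊆V edges cost (suc k) hard with Y? x ×-dec _~?_ G x y
... | no ¬edge = undominated⇒Acyclic E G Y? Y⊆V edges′ cost (suc k) hard
  where
  edges′ : ∀ u v → Y u → _~_ G u v → (u , v) ∈ˡ E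
  edges′ u v u∈Y u~v with edges u v u∈Y u~v
  ... | here refl = contradiction (u∈Y , u~v) ¬edge
  ... | there e   = e
-- Deleting the edge only makes domination harder, so the bound is inherited. Exploding it lowers
-- the degree by one and the bound by `c`.
... | yes (x∈Y , x~y) = edge⇒Acyclic G x y x~y k
  (undominated⇒Acyclic E (deleteEdge G x y) Y? Y⊆V
    (λ u v u∈Y (u~v , ¬e) → edges′ u v u∈Y u~v ¬e)
    (cost-delete cost) (suc k)
    λ X X⊆V dom → hard X X⊆V λ u u∈Y → let (v , v∈X , v~u , _) = dom u u∈Y in v , v∈X , v~u)
  (undominated⇒Acyclic E (explodeEdge G x y) (λ u → Y? u ×-dec (¬? (_~?_ G x u) ×-dec ¬? (_~?_ G y u)))
    (λ u (u∈Y , far) → Y⊆V u u∈Y , far)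
    (λ u v (u∈Y , _) (u~v , (x≁u , y≁u) , _) → edges′ u v u∈Y u~v λ
      { (inj₁ (refl , _)) → y≁u (~-sym G x~y) ; (inj₂ (refl , _)) → x≁u x~y })
    (cost-explode cost) k λ X X⊆V dom → ℕ.+-cancelˡ-< c _ _ (explode cost X X⊆V dom))
  where
  edges′ : ∀ u v → Y u → _~_ G u v → ¬ IsEdge G x y u v → (u , v) ∈ˡ E
  edges′ u v u∈Y u~v ¬e with edges u v u∈Y u~v
  ... | here refl = contradiction (inj₁ (refl , refl)) ¬e
  ... | there e   = e

  cost-delete : ∀ {c} → Cost G Y c → Cost (deleteEdge G x y) Y c
  cost-delete both-ends     = both-ends
  cost-delete (far-end ind) = far-end λ u v u∈ v∈ (u~v , _) → ind u v u∈ v∈ u~v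

  Y′ : Pred (Fin N) 0ℓ
  Y′ u = Y u × Far G x y u

  cost-explode : ∀ {c} → Cost G Y c → Cost (explodeEdge G x y) Y′ c
  cost-explode both-ends     = both-ends
  cost-explode (far-end ind) = far-end λ u v (u∈ , _) (v∈ , _) (u~v , _) → ind u v u∈ v∈ u~v

  insert-VertexSet : ∀ {X v} → Vertex G v → VertexSet G X → VertexSet G (X [ v ]≔ true)
  insert-VertexSet v∈V X⊆V u u∈ with ∈-insert⁻ u∈
  ... | inj₁ refl = v∈V
  ... | inj₂ u∈X  = X⊆V u u∈X

  y∈V : Vertex G y
  y∈V = ~⇒Vertex G (~-sym G x~y)

  -- A set dominating `Y′` in the exploded graph dominates all of `Y` in `G` once the ends counted
  -- by `c` are added. The enlarged set has more than `c * suc k` vertices by `hard`, and at most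
  -- `c` of them are new.
  explode : Cost G Y c → ∀ X → VertexSet (explodeEdge G x y) X → StronglyDominates (explodeEdge G x y) X Y′ →
            c + c * k < c + ∣ X ∣
  explode cost X X⊆V dom = ℕ.<-≤-trans (subst (_< ∣ X⁺ cost ∣) (ℕ.*-suc c k) (grow cost)) (small cost)
    where
    X⊆VG : VertexSet G X
    X⊆VG u u∈ = proj₁ (X⊆V u u∈)

    X⁺ : ∀ {c} → Cost G Y c → Subset N
    X⁺ both-ends   = X [ y ]≔ true [ x ]≔ true
    X⁺ (far-end _) = X [ y ]≔ true

    small : ∀ {c} (cost : Cost G Y c) → ∣ X⁺ cost ∣ ≤ c + ∣ X ∣
    small both-ends   = ℕ.≤-trans (∣insert∣≤ (X [ y ]≔ true) x) (s≤s (∣insert∣≤ X y))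
    small (far-end _) = ∣insert∣≤ X y

    X⁺⊆V : ∀ {c} (cost : Cost G Y c) → VertexSet G (X⁺ cost)
    X⁺⊆V both-ends   = insert-VertexSet (~⇒Vertex G x~y) (insert-VertexSet y∈V X⊆VG)
    X⁺⊆V (far-end _) = insert-VertexSet y∈V X⊆VG

    X⊆X⁺ : ∀ {c} (cost : Cost G Y c) {u} → u ∈ X → u ∈ X⁺ cost
    X⊆X⁺ both-ends   = ∈-insert⁺ x ∘ ∈-insert⁺ y
    X⊆X⁺ (far-end _) = ∈-insert⁺ y

    y∈X⁺ : ∀ {c} (cost : Cost G Y c) → y ∈ X⁺ cost
    y∈X⁺ both-ends   = ∈-insert⁺ x (∈-insert X y)
    y∈X⁺ (far-end _) = ∈-insert X y

    near-x : ∀ {c} (cost : Cost G Y c) {u} → Y u → _~_ G x u → x ∈ X⁺ cost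
    near-x both-ends     _   _   = ∈-insert (X [ y ]≔ true) x
    -- Both `x` and `u` lie in `Y`, which spans no edge, so the end `x` has nothing to dominate.
    near-x (far-end ind) u∈Y x~u = contradiction x~u (ind _ _ x∈Y u∈Y)

    grow : (cost : Cost G Y c) → c * suc k < ∣ X⁺ cost ∣
    grow cost = hard (X⁺ cost) (X⁺⊆V cost) dominates
      where
      dominates : StronglyDominates G (X⁺ cost) Y
      dominates u u∈Y with _~?_ G x u | _~?_ G y u
      ... | yes x~u | _       = x , near-x cost u∈Y x~u , x~u
      ... | no _    | yes y~u = y , y∈X⁺ cost , y~u
      ... | no x≁u  | no y≁u  = let (v , v∈X , v~u , _) = dom u (u∈Y , x≁u , y≁u) in
                                v , X⊆X⁺ cost v∈X , v~u

allPairs : ∀ N → List (Fin N × Fin N)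
allPairs N = cartesianProduct (allFin N) (allFin N)

∈-allPairs : (u v : Fin N) → (u , v) ∈ˡ allPairs N
∈-allPairs u v = ∈-cartesianProduct⁺ (∈-allFin u) (∈-allFin v)

-- Descent in the double complex.

not-true : ∀ {b} → not b ≡ true → b ≡ false
not-true {false} _ = refl

-- Together with δ, the map D makes the cochains of the Face J, J ⊆ [n], into a double complex.
Family : ℕ → ℕ → Set
Family n N = Subset n → Cochain N

D : Family n N → Family n N
D g K σ = sum λ i → not (lookup K i) ∧ g (K [ i ]≔ true) σ

-- The set `K + i + j` arises once by adding `i` first and once by adding `j` first, and the two
-- contributions cancel.
D∘D : (g : Family n N) → ∀ K σ → D (D g) K σ ≡ false
D∘D g K σ = trans
  (sum-cong-≗ λ i → sum-∧ (not (lookup K i)) λ j → not (lookup (K [ i ]≔ true) j) ∧ g (K [ i ]≔ true [ j ]≔ true) σ)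
  (sum-symmetric (λ i j → not (lookup K i) ∧ (not (lookup (K [ i ]≔ true) j) ∧ g (K [ i ]≔ true [ j ]≔ true) σ))
    (λ i → trans (cong (λ b → not (lookup K i) ∧ (not b ∧ g (K [ i ]≔ true [ i ]≔ true) σ)) (lookup∘update i K true)) (∧-zeroʳ _))
    symm)
  where
  open ≡-Reasoning
  symm : ∀ i j → not (lookup K i) ∧ (not (lookup (K [ i ]≔ true) j) ∧ g (K [ i ]≔ true [ j ]≔ true) σ) ≡
                 not (lookup K j) ∧ (not (lookup (K [ j ]≔ true) i) ∧ g (K [ j ]≔ true [ i ]≔ true) σ)
  symm i j with i ≟ j
  ... | yes refl = refl
  ... | no i≢j   = begin
    not (lookup K i) ∧ (not (lookup (K [ i ]≔ true) j) ∧ g (K [ i ]≔ true [ j ]≔ true) σ)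
      ≡⟨ cong₂ (λ b L → not (lookup K i) ∧ (not b ∧ g L σ)) (lookup∘update′ (i≢j ∘ sym) K true) ([]≔-commutes K i j i≢j) ⟩
    not (lookup K i) ∧ (not (lookup K j) ∧ G)
      ≡⟨ ∧-assoc (not (lookup K i)) _ _ ⟨
    (not (lookup K i) ∧ not (lookup K j)) ∧ G
      ≡⟨ cong (_∧ G) (∧-comm (not (lookup K i)) _) ⟩
    (not (lookup K j) ∧ not (lookup K i)) ∧ G
      ≡⟨ ∧-assoc (not (lookup K j)) _ _ ⟩
    not (lookup K j) ∧ (not (lookup K i) ∧ G)
      ≡⟨ cong (λ b → not (lookup K j) ∧ (not b ∧ G)) (lookup∘update′ i≢j K true) ⟨
    not (lookup K j) ∧ (not (lookup (K [ j ]≔ true) i) ∧ G) ∎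
    where G = g (K [ j ]≔ true [ i ]≔ true) σ

-- `δ` acts on the simplex and `D` on the index set, so the two sums can be interchanged.
δ∘D : (g : Family n N) → ∀ K σ → δ (D g K) σ ≡ D (λ J → δ (g J)) K σ
δ∘D g K σ = begin
  sum (λ v → lookup σ v ∧ sum λ i → not (lookup K i) ∧ g (K [ i ]≔ true) (σ [ v ]≔ false))
    ≡⟨ sum-cong-≗ (λ v → sum-∧ (lookup σ v) λ i → not (lookup K i) ∧ g (K [ i ]≔ true) (σ [ v ]≔ false)) ⟩
  sum (λ v → sum λ i → lookup σ v ∧ (not (lookup K i) ∧ g (K [ i ]≔ true) (σ [ v ]≔ false)))
    ≡⟨ ∑-comm (λ v i → lookup σ v ∧ (not (lookup K i) ∧ g (K [ i ]≔ true) (σ [ v ]≔ false))) ⟩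
  sum (λ i → sum λ v → lookup σ v ∧ (not (lookup K i) ∧ g (K [ i ]≔ true) (σ [ v ]≔ false)))
    ≡⟨ sum-cong-≗ (λ i → trans (sum-cong-≗ λ v → ∧-swap (lookup σ v) (not (lookup K i)) _)
                               (sym (sum-∧ (not (lookup K i)) λ v → lookup σ v ∧ g (K [ i ]≔ true) (σ [ v ]≔ false)))) ⟩
  D (λ J → δ (g J)) K σ ∎
  where
  open ≡-Reasoning
  ∧-swap : ∀ a b c → a ∧ (b ∧ c) ≡ b ∧ (a ∧ c)
  ∧-swap a b c = trans (sym (∧-assoc a b c)) (trans (cong (_∧ c) (∧-comm a b)) (∧-assoc b a c))

-- The faces are left abstract because the descent runs on two families: the independent sets in
-- `V_J`, and those in `V_J` enlarged by one fixed class.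
module Descent {n N : ℕ} (Face : Subset n → Pred (Subset N) 0ℓ)
  (mono : ∀ {K σ} i → Face K σ → Face (K [ i ]≔ true) σ)
  (acyclic : ∀ J {j} → ∣ J ∣ ≡ suc j → Acyclic (Face J) (suc j)) where

  -- A section picks from each Face J a simplex whose facets it picks from the Face (J − i).
  record Section (s : Subset n → Subset N) : Set where
    field
      face   : ∀ J → Face J (s J)
      size   : ∀ J → ∣ s J ∣ ≡ ∣ J ∣
      facets : ∀ h J → δ h (s J) ≡ sum λ i → lookup J i ∧ h (s (J [ i ]≔ false))

  -- A cocycle for both differentials on the diagonal where index set and simplex have `r` elements.
  -- `support` confines the sum `total` to this diagonal.
  record Compatible (r : ℕ) (f : Family n N) : Set where
    field
      support    : ∀ J → ∣ J ∣ ≢ r → ∀ σ → f J σ ≡ false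
      cocycle    : ∀ J → ∣ J ∣ ≡ r → ∀ τ → Face J τ → ∣ τ ∣ ≡ suc r → δ (f J) τ ≡ false
      compatible : ∀ K → suc ∣ K ∣ ≡ r → ∀ σ → Face K σ → ∣ σ ∣ ≡ r → D f K σ ≡ false

  total : Family n N → (Subset n → Subset N) → Bool
  total f s = sumSubsets λ J → f J (s J)

  module _ {r f} (c : Compatible (suc r) f) where
    open Compatible c

    potential : Family n N
    potential J with ∣ J ∣ ℕ.≟ suc r
    ... | yes e = proj₁ (acyclic J e (f J) (cocycle J e))
    -- The default 0 keeps `D potential` supported on index sets of size `r`.
    ... | no _  = λ _ → false

    potential-support : ∀ J → ∣ J ∣ ≢ suc r → ∀ σ → potential J σ ≡ false
    potential-support J ≢r σ with ∣ J ∣ ℕ.≟ suc r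
    ... | yes e = contradiction e ≢r
    ... | no _  = refl

    f≡δpotential : ∀ J → ∣ J ∣ ≡ suc r → ∀ σ → Face J σ → ∣ σ ∣ ≡ suc r → f J σ ≡ δ (potential J) σ
    f≡δpotential J ∣J∣ σ with ∣ J ∣ ℕ.≟ suc r
    ... | yes e = proj₂ (acyclic J e (f J) (cocycle J e)) σ
    ... | no ≢r = contradiction ∣J∣ ≢r

    -- By `δ∘D`, applying `δ` to `D potential` gives `D f` on faces, which vanishes by compatibility
    -- of `f`; the other condition is `D∘D`.
    descend : Compatible r (D potential)
    descend = record
      { support = λ K ≢r σ → sum-false _ λ i → ∧-false (lookup K i) λ i∉K →
          potential-support (K [ i ]≔ true) (λ e → ≢r (ℕ.suc-injective (trans (sym (∣insert∣ K i i∉K)) e))) σ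
      ; cocycle = λ K ∣K∣ τ τ∈ ∣τ∣ → trans (δ∘D potential K τ) (trans
          (sum-cong-≗ λ i → ∧-congʳ-true (not (lookup K i)) λ i∉K →
            sym (f≡δpotential (K [ i ]≔ true) (trans (∣insert∣ K i (not-true i∉K)) (cong suc ∣K∣)) τ (mono i τ∈) ∣τ∣))
          (compatible K (cong suc ∣K∣) τ τ∈ ∣τ∣))
      ; compatible = λ K _ σ _ _ → D∘D potential K σ
      }
      where
      ∧-false : ∀ b {c} → (b ≡ false → c ≡ false) → not b ∧ c ≡ false
      ∧-false true  h = refl
      ∧-false false h = h refl

    -- With `f J = δ (potential J)`, expanding over the facets `s (J - i)` of `s J` gives a sum over
    -- pairs `i ∈ J`. Regrouped by `K = J - i`, it is the total of `D potential`.
    total-descend : ∀ {s} → Section s → total f s ≡ total (D potential) s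
    total-descend {s} sec = begin
      sumSubsets (λ J → f J (s J))
        ≡⟨ sumSubsets-cong f≡δ ⟩
      sumSubsets (λ J → δ (potential J) (s J))
        ≡⟨ sumSubsets-cong (λ J → facets (potential J) J) ⟩
      sumSubsets (λ J → sum λ i → lookup J i ∧ potential J (s (J [ i ]≔ false)))
        ≡⟨ sumSubsets-sum (λ J i → lookup J i ∧ potential J (s (J [ i ]≔ false))) ⟩
      sum (λ i → sumSubsets λ J → lookup J i ∧ potential J (s (J [ i ]≔ false)))
        ≡⟨ sum-cong-≗ (λ i → sumSubsets-shift i (λ J → potential J (s (J [ i ]≔ false)))) ⟩
      sum (λ i → sumSubsets λ K → not (lookup K i) ∧ potential (K [ i ]≔ true) (s (K [ i ]≔ true [ i ]≔ false)))
        ≡⟨ sum-cong-≗ (λ i → sumSubsets-cong λ K → ∧-congʳ-true (not (lookup K i)) λ i∉K →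
             cong (λ L → potential (K [ i ]≔ true) (s L)) (insert-delete K i (not-true i∉K))) ⟩
      sum (λ i → sumSubsets λ K → not (lookup K i) ∧ potential (K [ i ]≔ true) (s K))
        ≡⟨ sumSubsets-sum (λ K i → not (lookup K i) ∧ potential (K [ i ]≔ true) (s K)) ⟨
      sumSubsets (λ K → D potential K (s K)) ∎
      where
      open ≡-Reasoning
      open Section sec
      f≡δ : ∀ J → f J (s J) ≡ δ (potential J) (s J)
      f≡δ J = case-size (∣ J ∣ ℕ.≟ suc r)
        where
        case-size : Dec (∣ J ∣ ≡ suc r) → f J (s J) ≡ δ (potential J) (s J)
        case-size (yes e) = f≡δpotential J e (s J) (face J) (trans (size J) e)
        case-size (no ≢r) = trans (support J ≢r (s J)) (sym (sum-false _ λ v →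
          trans (cong (lookup (s J) v ∧_) (potential-support J ≢r _)) (∧-zeroʳ _)))

  -- After `r` descents only the index `⊥` is left, and every section sends it to the empty set, so
  -- nothing depends on the section any more. The last clause serves the existence proof: acyclicity
  -- of `Face ⊥` in degree 0 forces the remaining value to be 0.
  total-constant : ∀ r f → Compatible r f →
    ∃[ κ ] (∀ s → Section s → total f s ≡ κ) × (Acyclic (Face ⊥) 0 → Face ⊥ ⊥ → κ ≡ false)
  total-constant (suc r) f c =
    let (κ , const , vanish) = total-constant r (D (potential c)) (descend c) in
    κ , (λ s sec → trans (total-descend c sec) (const s sec)) , vanish
  total-constant zero f c = f ⊥ ⊥ ,
    (λ s sec → trans (sumSubsets-only-⊥ (λ J → f J (s J)) λ J ≢0 → support J ≢0 (s J))
      (cong (f ⊥) (∣p∣≡0⇒p≡⊥ (s ⊥) (trans (Section.size sec ⊥) (∣⊥∣≡0 n))))) ,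
    λ acyc ⊥∈ → let (g , f≡δg) = acyc (f ⊥) (cocycle ⊥ (∣⊥∣≡0 n)) in
      trans (f≡δg ⊥ ⊥∈ (∣⊥∣≡0 N)) (δ-⊥ g ⊥ λ v → ∉⇒false {v = v} ∉⊥)
    where
    open Compatible c
    ∣p∣≡0⇒p≡⊥ : ∀ {m} (p : Subset m) → ∣ p ∣ ≡ 0 → p ≡ ⊥
    ∣p∣≡0⇒p≡⊥ []          _ = refl
    ∣p∣≡0⇒p≡⊥ (false ∷ p) e = cong (false ∷_) (∣p∣≡0⇒p≡⊥ p e)

  constant-on-sections : (A : Cochain N) →
    (∀ τ → Face ⊤ τ → ∣ τ ∣ ≡ suc n → δ A τ ≡ false) →
    (∀ K i → lookup K i ≡ false → ∀ σ → Face K σ → A σ ≡ false) →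
    ∃[ κ ] (∀ s → Section s → A (s ⊤) ≡ κ) × (Acyclic (Face ⊥) 0 → Face ⊥ ⊥ → κ ≡ false)
  constant-on-sections A A-cocycle A-vanishes =
    let (κ , const , vanish) = total-constant n f compat in
    κ , (λ s sec → trans (sym (total-f s)) (const s sec)) , vanish
    where
    -- `A` is placed at the only index set of size `n`, namely `⊤`. Compatibility one level below
    -- holds because `A` vanishes on `Face K` whenever `K` misses an index.
    f : Family n N
    f J σ = does (∣ J ∣ ℕ.≟ n) ∧ A σ

    f-top : ∀ J → ∣ J ∣ ≡ n → ∀ σ → f J σ ≡ A σ
    f-top J ∣J∣ σ = cong (_∧ A σ) (dec-true (∣ J ∣ ℕ.≟ n) ∣J∣)

    f-support : ∀ J → ∣ J ∣ ≢ n → ∀ σ → f J σ ≡ false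
    f-support J ≢n σ = cong (_∧ A σ) (dec-false (∣ J ∣ ℕ.≟ n) ≢n)

    total-f : ∀ s → total f s ≡ A (s ⊤)
    total-f s = trans (sumSubsets-only-⊤ (λ J → f J (s J)) λ J ≢n → f-support J ≢n (s J))
                      (f-top ⊤ (∣⊤∣≡n n) (s ⊤))

    compat : Compatible n f
    compat = record
      { support = f-support
      ; cocycle = λ J ∣J∣ τ τ∈ ∣τ∣ → trans (δ-cong (f J) A τ λ v _ → f-top J ∣J∣ (τ [ v ]≔ false))
          (A-cocycle τ (subst (λ J → Face J τ) (∣p∣≡n⇒p≡⊤ ∣J∣) τ∈) ∣τ∣)
      ; compatible = λ K _ σ σ∈ _ → sum-false _ λ i → trans
          (∧-congʳ-true (not (lookup K i)) λ i∉K →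
            trans (cong (does (∣ K [ i ]≔ true ∣ ℕ.≟ n) ∧_) (A-vanishes K i (not-true i∉K) σ σ∈)) (∧-zeroʳ _))
          (∧-zeroʳ _)
      }

-- Decidable reachability in a finite graph.

does-true : {P : Set} (P? : Dec P) → does P? ≡ true → P
does-true (yes p) _ = p

-- The indicator of a component has to be a Boolean function, so reachability must be decidable.
module Reachability {A : Set} {R : Rel A 0ℓ} (_≟ᴬ_ : B.DecidableEquality A) (R? : B.Decidable R) where

  -- Floyd–Warshall: there is a walk whose inner points all lie in L.
  Via : List A → Rel A 0ℓ
  Via []      u v = u ≡ v ⊎ R u v
  Via (x ∷ L) u v = Via L u v ⊎ (Via L u x × Via L x v)

  via? : ∀ L → B.Decidable (Via L)
  via? []      u v = (u ≟ᴬ v) ⊎-dec R? u v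
  via? (x ∷ L) u v = via? L u v ⊎-dec (via? L u x ×-dec via? L x v)

  via⇒Star : ∀ L {u v} → Via L u v → Star R u v
  via⇒Star []      (inj₁ refl)    = ε
  via⇒Star []      (inj₂ r)       = r ◅ ε
  via⇒Star (x ∷ L) (inj₁ p)       = via⇒Star L p
  via⇒Star (x ∷ L) (inj₂ (p , q)) = via⇒Star L p ◅◅ via⇒Star L q

  via-refl : ∀ L {u} → Via L u u
  via-refl []      = inj₁ refl
  via-refl (_ ∷ L) = inj₁ (via-refl L)

  via-step : ∀ L {u v} → R u v → Via L u v
  via-step []      r = inj₂ r
  via-step (_ ∷ L) r = inj₁ (via-step L r)

  via-trans : ∀ L {u x v} → x ∈ˡ L → Via L u x → Via L x v → Via L u v
  via-trans (x ∷ L) (here refl) p q = inj₂ (to p , from q)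
    where
    to : ∀ {u} → Via (x ∷ L) u x → Via L u x
    to (inj₁ p)       = p
    to (inj₂ (p , _)) = p
    from : ∀ {v} → Via (x ∷ L) x v → Via L x v
    from (inj₁ q)       = q
    from (inj₂ (_ , q)) = q
  via-trans (y ∷ L) (there x∈L) (inj₁ p)        (inj₁ q)        = inj₁ (via-trans L x∈L p q)
  via-trans (y ∷ L) (there x∈L) (inj₁ p)        (inj₂ (q , q′)) = inj₂ (via-trans L x∈L p q , q′)
  via-trans (y ∷ L) (there x∈L) (inj₂ (p , p′)) (inj₁ q)        = inj₂ (p , via-trans L x∈L p′ q)
  -- Both walks visit `y`, so the detour from `y` through `x` back to `y` is skipped.
  via-trans (y ∷ L) (there x∈L) (inj₂ (p , _))  (inj₂ (_ , q))  = inj₂ (p , q)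

subsets : ∀ N → List (Subset N)
subsets zero    = [] ∷ []
subsets (suc N) = map (true ∷_) (subsets N) ++ map (false ∷_) (subsets N)

∈-subsets : (σ : Subset N) → σ ∈ˡ subsets N
∈-subsets []          = here refl
∈-subsets (true ∷ σ)  = ∈-++⁺ˡ (∈-map⁺ (true ∷_) (∈-subsets σ))
∈-subsets {suc N} (false ∷ σ) = ∈-++⁺ʳ (map (true ∷_) (subsets N)) (∈-map⁺ (false ∷_) (∈-subsets σ))

-- Partial transversals as images of index sets.

image : (Fin m → Fin N) → Subset m → Subset N
image t []          = ⊥
image t (true ∷ J)  = image (t ∘ suc) J [ t zero ]≔ true
image t (false ∷ J) = image (t ∘ suc) J

∈-image⁻ : (t : Fin m → Fin N) (J : Subset m) → ∀ {v} → v ∈ image t J → ∃[ i ] i ∈ J × v ≡ t i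
∈-image⁻ t []          v∈ = contradiction v∈ ∉⊥
∈-image⁻ t (true ∷ J)  v∈ with ∈-insert⁻ v∈
... | inj₁ v≡t₀ = zero , here , v≡t₀
... | inj₂ v∈′  = let (i , i∈J , v≡) = ∈-image⁻ (t ∘ suc) J v∈′ in suc i , there i∈J , v≡
∈-image⁻ t (false ∷ J) v∈ = let (i , i∈J , v≡) = ∈-image⁻ (t ∘ suc) J v∈ in suc i , there i∈J , v≡

∈-image⁺ : (t : Fin m → Fin N) (J : Subset m) → ∀ {i} → i ∈ J → t i ∈ image t J
∈-image⁺ t (true ∷ J)  here        = ∈-insert (image (t ∘ suc) J) (t zero)
∈-image⁺ t (true ∷ J)  (there i∈J) = ∈-insert⁺ (t zero) (∈-image⁺ (t ∘ suc) J i∈J)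
∈-image⁺ t (false ∷ J) (there i∈J) = ∈-image⁺ (t ∘ suc) J i∈J

module _ (t : Fin (suc m) → Fin N) (t-inj : Injective _≡_ _≡_ t) where

  tail-injective : Injective _≡_ _≡_ (t ∘ suc)
  tail-injective = suc-injective ∘ t-inj

  head∉image : ∀ J → lookup (image (t ∘ suc) J) (t zero) ≡ false
  head∉image J = ∉⇒false λ t₀∈ → let (i , _ , t₀≡) = ∈-image⁻ (t ∘ suc) J t₀∈ in
                                 contradiction (t-inj t₀≡) λ ()

∣image∣ : (t : Fin m → Fin N) → Injective _≡_ _≡_ t → ∀ J → ∣ image t J ∣ ≡ ∣ J ∣
∣image∣ {N = N} t t-inj []          = ∣⊥∣≡0 N
∣image∣ t t-inj (true ∷ J)  = trans (∣insert∣ (image (t ∘ suc) J) (t zero) (head∉image t t-inj J))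
                                    (cong suc (∣image∣ (t ∘ suc) (tail-injective t t-inj) J))
∣image∣ t t-inj (false ∷ J) = ∣image∣ (t ∘ suc) (tail-injective t t-inj) J

-- By injectivity, the facets of the image of `J` are the images of the sets `J - i`. In the
-- induction, `δ-insert` absorbs the head vertex into the cochain.
δ-image : (t : Fin m → Fin N) → Injective _≡_ _≡_ t → ∀ h J →
          δ h (image t J) ≡ sum λ i → lookup J i ∧ h (image t (J [ i ]≔ false))
δ-image t t-inj h []          = δ-⊥ h ⊥ λ v → ∉⇒false {v = v} ∉⊥
δ-image t t-inj h (true ∷ J)  = trans
  (δ-insert h (t zero) (image (t ∘ suc) J) (head∉image t t-inj J))
  (cong (h (image (t ∘ suc) J) xor_)
    (δ-image (t ∘ suc) (tail-injective t t-inj) (λ μ → h (μ [ t zero ]≔ true)) J))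
δ-image t t-inj h (false ∷ J) = δ-image (t ∘ suc) (tail-injective t t-inj) h J

-- Independent transversals and exchanges.

module _ (G : FiniteGraph N) where

  InClasses : (Fin m → Subset N) → Subset m → Pred (Subset N) 0ℓ
  InClasses cls J σ = ∀ v → v ∈ σ → ∃[ i ] i ∈ J × v ∈ cls i

  Face : (Fin m → Subset N) → Subset m → Pred (Subset N) 0ℓ
  Face cls J σ = Independent G σ × InClasses cls J σ

  -- Containment in the union of the classes is part of the notion, as it is also applied to
  -- families that need not cover the vertices of `G`.
  IT : (Fin m → Subset N) → Pred (Subset N) 0ℓ
  IT cls σ = Face cls ⊤ σ × (∀ i → ∃! _≡_ λ v → v ∈ σ × v ∈ cls i)

  IT? : (cls : Fin m → Subset N) → Decidable (IT cls)
  IT? cls σ = (independent? G σ ×-dec all? λ v → (v ∈? σ) →-dec any? λ i → (i ∈? ⊤) ×-dec (v ∈? cls i))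
    ×-dec all? λ i → any? λ v → ((v ∈? σ) ×-dec (v ∈? cls i)) ×-dec
      map′ (λ unique {y} → unique y) (λ unique y → unique {y})
        (all? λ y → ((y ∈? σ) ×-dec (y ∈? cls i)) →-dec (v ≟ y))

  Independent-⊆ : ∀ {σ τ : Subset N} → (∀ {v} → v ∈ σ → v ∈ τ) → Independent G τ → Independent G σ
  Independent-⊆ σ⊆τ = Complex.down-closed (𝓘 G) σ⊆τ

  ⊥-Face : (cls : Fin m → Subset N) (J : Subset m) → Face cls J ⊥
  ⊥-Face cls J = ((λ _ x∈ → contradiction x∈ ∉⊥) , λ _ _ x∈ → contradiction x∈ ∉⊥) , λ _ x∈ → contradiction x∈ ∉⊥

  Face-mono : (cls : Fin m → Subset N) → ∀ {K σ} i → Face cls K σ → Face cls (K [ i ]≔ true) σ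
  Face-mono cls i (ind , σ⊆) = ind , λ v v∈ → let (k , k∈K , v∈k) = σ⊆ v v∈ in k , ∈-insert⁺ i k∈K , v∈k

  module _ {cls : Fin m → Subset N} (disjoint : ∀ {i j v} → v ∈ cls i → v ∈ cls j → i ≡ j) where

    module _ {σ : Subset N} (it : IT cls σ) where

      choose : Fin m → Fin N
      choose i = proj₁ (proj₂ it i)

      choose-injective : Injective _≡_ _≡_ choose
      choose-injective {i} {j} e = disjoint (proj₂ (proj₁ (proj₂ (proj₂ it i))))
        (subst (_∈ cls j) (sym e) (proj₂ (proj₁ (proj₂ (proj₂ it j)))))

      image-choose⊆ : ∀ J {v} → v ∈ image choose J → v ∈ σ
      image-choose⊆ J v∈ with ∈-image⁻ choose J v∈
      ... | i , _ , refl = proj₁ (proj₁ (proj₂ (proj₂ it i)))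

      image-choose : image choose ⊤ ≡ σ
      image-choose = ⊆-antisym (image-choose⊆ ⊤) λ {v} v∈σ →
        let (i , _ , v∈i) = proj₂ (proj₁ it) v v∈σ in
        subst (_∈ image choose ⊤) (proj₂ (proj₂ (proj₂ it i)) (v∈σ , v∈i)) (∈-image⁺ choose ⊤ (∈⊤ {x = i}))

      Face-image : ∀ J → Face cls J (image choose J)
      Face-image J = Independent-⊆ (image-choose⊆ J) (proj₁ (proj₁ it)) , λ v v∈ →
        let (i , i∈J , v≡) = ∈-image⁻ choose J v∈ in
        i , i∈J , subst (_∈ cls i) (sym v≡) (proj₂ (proj₁ (proj₂ (proj₂ it i))))

    -- The class of `v` meets `τ` in exactly two vertices, `v` and the representative `w` in
    -- `τ - v`, and every other class meets it once. Only the deletion of one of these two leaves a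
    -- transversal.
    exchange : ∀ {τ v i} → Independent G τ → v ∈ τ → v ∈ cls i → IT cls (τ [ v ]≔ false) →
      ∃[ w ] w ≢ v × w ∈ τ × IT cls (τ [ w ]≔ false) ×
             (∀ u → u ≢ v → u ≢ w → ¬ IT cls (τ [ u ]≔ false))
    exchange {τ} {v} {i} ind v∈τ v∈i ((_ , ⊆cls) , trans-v) = w , w≢v , w∈τ , it-w , others
      where
      w : Fin N
      w = proj₁ (trans-v i)
      w∈τ-v : w ∈ τ [ v ]≔ false
      w∈τ-v = proj₁ (proj₁ (proj₂ (trans-v i)))
      w∈i : w ∈ cls i
      w∈i = proj₂ (proj₁ (proj₂ (trans-v i)))
      w≢v : w ≢ v
      w≢v = proj₁ (∈-delete⁻ {σ = τ} w∈τ-v)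
      w∈τ : w ∈ τ
      w∈τ = proj₂ (∈-delete⁻ {σ = τ} w∈τ-v)

      in-class : ∀ u → u ∈ τ → ∃[ j ] j ∈ ⊤ × u ∈ cls j
      in-class u u∈τ with u ≟ v
      ... | yes refl = i , ∈⊤ , v∈i
      ... | no u≢v   = ⊆cls u (∈-delete⁺ u≢v u∈τ)

      transversal : ∀ j → ∃! _≡_ λ u → u ∈ τ [ w ]≔ false × u ∈ cls j
      transversal j with j ≟ i
      ... | yes refl = v , (∈-delete⁺ (w≢v ∘ sym) v∈τ , v∈i) , unique
        where
        unique : ∀ {y} → y ∈ τ [ w ]≔ false × y ∈ cls i → v ≡ y
        unique {y} (y∈ , y∈i) with y ≟ v
        ... | yes y≡v = sym y≡v
        ... | no y≢v  = let (y≢w , y∈τ) = ∈-delete⁻ {σ = τ} y∈ in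
          contradiction (sym (proj₂ (proj₂ (trans-v i)) (∈-delete⁺ y≢v y∈τ , y∈i))) y≢w
      ... | no j≢i = let (u , (u∈ , u∈j) , unique) = trans-v j in
        u , (∈-delete⁺ (λ u≡w → j≢i (disjoint u∈j (subst (_∈ cls i) (sym u≡w) w∈i))) (proj₂ (∈-delete⁻ {σ = τ} u∈)) , u∈j) ,
        λ (y∈ , y∈j) → unique (∈-delete⁺ (λ { refl → j≢i (disjoint y∈j v∈i) }) (proj₂ (∈-delete⁻ {σ = τ} y∈)) , y∈j)

      it-w : IT cls (τ [ w ]≔ false)
      it-w = (Independent-⊆ (λ u∈ → proj₂ (∈-delete⁻ {σ = τ} u∈)) ind ,
              λ u u∈ → in-class u (proj₂ (∈-delete⁻ {σ = τ} u∈))) , transversal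

      others : ∀ u → u ≢ v → u ≢ w → ¬ IT cls (τ [ u ]≔ false)
      others u u≢v u≢w (_ , trans-u) = w≢v (trans
        (sym (proj₂ (proj₂ (trans-u i)) (∈-delete⁺ (u≢w ∘ sym) w∈τ , w∈i)))
        (proj₂ (proj₂ (trans-u i)) (∈-delete⁺ (u≢v ∘ sym) v∈τ , v∈i)))

    -- The value counts modulo 2 the facets of `τ` selected by `A`. If there is one, `exchange`
    -- yields exactly one further transversal among the facets, and `closed` shows that `A` selects
    -- it; so the count is 0 or 2.
    exchange-closed⇒cocycle : (A : Cochain N) → (∀ σ → A σ ≡ true → IT cls σ) →
      ∀ {τ} → Independent G τ →
      (∀ v → v ∈ τ → A (τ [ v ]≔ false) ≡ true → ∃[ i ] v ∈ cls i) →
      (∀ v w → v ∈ τ → w ∈ τ → w ≢ v → A (τ [ v ]≔ false) ≡ true → IT cls (τ [ w ]≔ false) → A (τ [ w ]≔ false) ≡ true) →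
      δ A τ ≡ false
    exchange-closed⇒cocycle A A⇒IT {τ} ind in-class closed with any? (λ v → (lookup τ v ∧ A (τ [ v ]≔ false)) ≟ᵇ true)
    ... | no none = sum-false _ λ v → ¬-not λ e → none (v , e)
    ... | yes (v , e) = begin
      sum a            ≡⟨ sum-split v {b = b} (cong (λ d → not d ∧ a v) (dec-true (v ≟ v) refl))
                           (λ u u≢v → cong (λ d → not d ∧ a u) (sym (dec-false (u ≟ v) u≢v))) ⟩
      a v xor sum b    ≡⟨ cong₂ _xor_ e (trans (sum-single w b-other) b-w) ⟩
      true xor true    ≡⟨⟩
      false            ∎
      where
      open ≡-Reasoning
      a b : Fin N → Bool
      a u = lookup τ u ∧ A (τ [ u ]≔ false)
      b u = not (does (u ≟ v)) ∧ a u

      ∧-true : ∀ {c d} → c ∧ d ≡ true → c ≡ true × d ≡ true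
      ∧-true {true} {true} _ = refl , refl

      v∈τ : v ∈ τ
      v∈τ = lookup⇒[]= v τ (proj₁ (∧-true e))
      Av : A (τ [ v ]≔ false) ≡ true
      Av = proj₂ (∧-true e)

      pair = exchange ind v∈τ (proj₂ (in-class v v∈τ Av)) (A⇒IT _ Av)
      w = proj₁ pair
      w≢v = proj₁ (proj₂ pair)
      w∈τ = proj₁ (proj₂ (proj₂ pair))
      it-w = proj₁ (proj₂ (proj₂ (proj₂ pair)))
      others = proj₂ (proj₂ (proj₂ (proj₂ pair)))

      b-w : b w ≡ true
      b-w = cong₂ (λ d c → not d ∧ c) (dec-false (w ≟ v) w≢v)
              (cong₂ _∧_ ([]=⇒lookup w∈τ) (closed v w v∈τ w∈τ w≢v Av it-w))

      b-other : ∀ u → u ≢ w → b u ≡ false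
      b-other u u≢w with u ≟ v
      ... | yes _  = refl
      ... | no u≢v = trans (cong (lookup τ u ∧_) (¬-not λ Au → others u u≢v u≢w (A⇒IT _ Au))) (∧-zeroʳ _)

    IT-meets-every-class : ∀ {σ K i} → lookup K i ≡ false → InClasses cls K σ → ¬ IT cls σ
    IT-meets-every-class {σ} {K} {i} i∉K σ⊆ (_ , transversal) =
      let (v , (v∈σ , v∈i) , _) = transversal i
          (k , k∈K , v∈k) = σ⊆ v v∈σ
      in contradiction (trans (sym ([]=⇒lookup (subst (_∈ K) (disjoint v∈k v∈i) k∈K))) i∉K) λ ()

  -- Existence of an independent transversal, by induction on the number of classes.

  exists-IT : ∀ m (cls : Fin m → Subset N) → (∀ {i j v} → v ∈ cls i → v ∈ cls j → i ≡ j) →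
    (∀ J j → ∣ J ∣ ≡ suc j → Acyclic (Face cls J) j) → ∃ (IT cls)
  exists-IT zero    cls disjoint acyc = ⊥ , ⊥-Face cls ⊤ , λ ()
  exists-IT (suc m) cls disjoint acyc with anySubset? (IT? cls)
  ... | yes found = found
  ... | no none = contradiction
    -- The indicator `ρ` is 1 on the transversal found for `rest`, while the descent gives it the
    -- value 0.
    (trans (sym (dec-true (IT? rest (image t ⊤)) (subst (IT rest) (sym (image-choose disjoint′ it)) it)))
      (trans (const (image t) section) (vanish (acyc (true ∷ ⊥) 0 (cong suc (∣⊥∣≡0 m))) (⊥-Face cls (true ∷ ⊥)))))
    λ ()
    where
    rest : Fin m → Subset N
    rest = cls ∘ suc

    disjoint′ : ∀ {i j v} → v ∈ rest i → v ∈ rest j → i ≡ j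
    disjoint′ v∈i v∈j = suc-injective (disjoint v∈i v∈j)

    rest-IT : ∃ (IT rest)
    rest-IT = exists-IT m rest disjoint′ λ J j ∣J∣ → Acyclic-resp {P = Face cls (false ∷ J)} {Q = Face rest J}
      (λ (ind , σ⊆) → ind , λ v v∈ → drop (σ⊆ v v∈))
      (λ (ind , σ⊆) → ind , λ v v∈ → let (i , i∈J , v∈i) = σ⊆ v v∈ in suc i , there i∈J , v∈i)
      (acyc (false ∷ J) j ∣J∣)
      where
      drop : ∀ {J v} → ∃[ i ] i ∈ false ∷ J × v ∈ cls i → ∃[ i ] i ∈ J × v ∈ rest i
      drop (suc i , there i∈J , v∈i) = i , i∈J , v∈i

    it = proj₂ rest-IT
    t = choose disjoint′ it

    Face₀ : Subset m → Pred (Subset N) 0ℓ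
    Face₀ J = Face cls (true ∷ J)

    -- The set `true ∷ J` has one class more than `J`, so acyclicity in degree one below the number
    -- of classes is what the descent over `J` asks for.
    open Descent Face₀ (λ i → Face-mono cls (suc i)) (λ J {j} ∣J∣ → acyc (true ∷ J) (suc j) (cong suc ∣J∣))

    section : Section (image t)
    section = record
      { face   = λ J → let (ind , σ⊆) = Face-image disjoint′ it J in
                 ind , λ v v∈ → let (i , i∈J , v∈i) = σ⊆ v v∈ in suc i , there i∈J , v∈i
      ; size   = ∣image∣ t (choose-injective disjoint′ it)
      ; facets = δ-image t (choose-injective disjoint′ it)
      }

    ρ : Cochain N
    ρ σ = does (IT? rest σ)

    -- If deleting a vertex of the first class left a transversal of `rest`, then `τ` would be a
    -- transversal of all classes, against `none`. This lets `in-rest` place every relevant vertex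
    -- in `rest`.
    extend : ∀ {τ v} → Face cls ⊤ τ → v ∈ τ → v ∈ cls zero → IT rest (τ [ v ]≔ false) → IT cls τ
    extend {τ} {v} τ-face v∈τ v∈₀ ((_ , ⊆rest) , transversal′) = τ-face , transversal
      where
      transversal : ∀ i → ∃! _≡_ λ u → u ∈ τ × u ∈ cls i
      transversal zero = v , (v∈τ , v∈₀) , unique
        where
        unique : ∀ {y} → y ∈ τ × y ∈ cls zero → v ≡ y
        unique {y} (y∈τ , y∈₀) with y ≟ v
        ... | yes y≡v = sym y≡v
        ... | no y≢v  = let (_ , _ , y∈j) = ⊆rest y (∈-delete⁺ y≢v y∈τ) in
                        contradiction (disjoint y∈₀ y∈j) λ ()
      transversal (suc i) = let (u , (u∈ , u∈i) , unique) = transversal′ i in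
        u , (proj₂ (∈-delete⁻ {σ = τ} u∈) , u∈i) ,
        λ (y∈τ , y∈i) → unique (∈-delete⁺ (λ { refl → contradiction (disjoint y∈i v∈₀) λ () }) y∈τ , y∈i)

    result = constant-on-sections ρ
      (λ τ τ-face _ → exchange-closed⇒cocycle disjoint′ ρ (λ σ → does-true (IT? rest σ)) (proj₁ τ-face)
        (λ v v∈τ ρv → in-rest τ-face v∈τ (does-true (IT? rest _) ρv) (proj₂ τ-face v v∈τ))
        -- Closure under exchange is immediate, as `ρ` selects all transversals of `rest`.
        λ v w _ _ _ _ → dec-true (IT? rest _))
      (λ K i i∉K σ (_ , σ⊆) → dec-false (IT? rest σ) λ it′ →
        let (v , (v∈σ , v∈i) , _) = proj₂ it′ i in
        misses i∉K v∈i (σ⊆ v v∈σ))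
      where
      in-rest : ∀ {τ v} → Face cls ⊤ τ → v ∈ τ → IT rest (τ [ v ]≔ false) →
                ∃[ i ] i ∈ ⊤ × v ∈ cls i → ∃[ i ] v ∈ rest i
      in-rest τ-face v∈τ it′ (zero  , _ , v∈₀) = contradiction (_ , extend τ-face v∈τ v∈₀ it′) none
      in-rest τ-face v∈τ it′ (suc i , _ , v∈i) = i , v∈i
      misses : ∀ {K i v} → lookup K i ≡ false → v ∈ rest i → ¬ (∃[ k ] k ∈ true ∷ K × v ∈ cls k)
      misses i∉K v∈i (k , k∈ , v∈k) with disjoint v∈k v∈i
      ... | refl = contradiction (trans (sym ([]=⇒lookup k∈)) i∉K) λ ()

    const = proj₁ (proj₂ result)
    vanish = proj₂ (proj₂ result)

-- Connectedness of the graph of independent transversals.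

module _ {N n : ℕ} (G : FiniteGraph N) (𝓥 : Partition (Vertex G) n) where
  open Partition 𝓥

  RG-vertex⇒IT : ∀ {S} → Graph.Vertex (RG (𝓘 G) 𝓥) S → IT G class S
  RG-vertex⇒IT (ind@(S⊆V , _) , transversal) =
    (ind , λ v v∈S → let (i , v∈i) = covers (S⊆V v v∈S) in i , ∈⊤ , v∈i) , transversal

  IT⇒RG-vertex : ∀ {S} → IT G class S → Graph.Vertex (RG (𝓘 G) 𝓥) S
  IT⇒RG-vertex ((ind , _) , transversal) = ind , transversal

  RG-vertex? : Decidable (Graph.Vertex (RG (𝓘 G) 𝓥))
  RG-vertex? S = map′ IT⇒RG-vertex RG-vertex⇒IT (IT? G class S)

  _≟ˢ_ : B.DecidableEquality (Subset N)
  _≟ˢ_ = ≡-dec _≟ᵇ_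

  RG-adjacent? : B.Decidable (Graph._~_ (RG (𝓘 G) 𝓥))
  RG-adjacent? S T = RG-vertex? S ×-dec RG-vertex? T ×-dec ¬? (S ≟ˢ T) ×-dec
    independent? G (S ∪ T) ×-dec (∣ S ∪ T ∣ ℕ.≟ suc n)

  -- Since `v` and `w` differ, the union of the two deletions is `τ` itself, an independent set of
  -- size `n + 1`.
  exchange-adjacent : ∀ {τ v w} → Independent G τ → ∣ τ ∣ ≡ suc n → v ∈ τ → w ≢ v →
    IT G class (τ [ v ]≔ false) → IT G class (τ [ w ]≔ false) →
    Graph._~_ (RG (𝓘 G) 𝓥) (τ [ v ]≔ false) (τ [ w ]≔ false)
  exchange-adjacent {τ} {v} {w} ind ∣τ∣ v∈τ w≢v it-v it-w = IT⇒RG-vertex it-v , IT⇒RG-vertex it-w ,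
    (λ e → proj₁ (∈-delete⁻ {σ = τ} (subst (v ∈_) (sym e) (∈-delete⁺ (w≢v ∘ sym) v∈τ))) refl) ,
    subst (Independent G) (sym ∪≡τ) ind , trans (cong ∣_∣ ∪≡τ) ∣τ∣
    where
    ∪⊆τ : ∀ {u} → u ∈ (τ [ v ]≔ false) ∪ (τ [ w ]≔ false) → u ∈ τ
    ∪⊆τ u∈ with x∈p∪q⁻ (τ [ v ]≔ false) (τ [ w ]≔ false) u∈
    ... | inj₁ u∈′ = proj₂ (∈-delete⁻ {σ = τ} u∈′)
    ... | inj₂ u∈′ = proj₂ (∈-delete⁻ {σ = τ} u∈′)
    τ⊆∪ : ∀ {u} → u ∈ τ → u ∈ (τ [ v ]≔ false) ∪ (τ [ w ]≔ false)
    τ⊆∪ {u} u∈τ with u ≟ v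
    ... | yes refl = x∈p∪q⁺ (inj₂ (∈-delete⁺ (w≢v ∘ sym) u∈τ))
    ... | no u≢v   = x∈p∪q⁺ (inj₁ (∈-delete⁺ u≢v u∈τ))
    ∪≡τ : (τ [ v ]≔ false) ∪ (τ [ w ]≔ false) ≡ τ
    ∪≡τ = ⊆-antisym ∪⊆τ τ⊆∪

  acyclic⇒Connected : (∀ I → Nonempty I → ∀ j → j ≤ ∣ I ∣ → Acyclic (Independent (induced G (⋃Class? I))) j) →
                      Connected (RG (𝓘 G) 𝓥)
  acyclic⇒Connected acyc =
    -- Existence uses acyclicity in degree `∣ J ∣ - 1`, the descent for connectedness in degree
    -- `∣ J ∣`.
    (let (S , it) = exists-IT G n class disjoint (λ J j ∣J∣ → face-acyclic J ∣J∣ (ℕ.≤-trans (ℕ.n≤1+n j) (ℕ.≤-reflexive (sym ∣J∣))))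
     in S , IT⇒RG-vertex it) ,
    λ S T S∈ T∈ → connect (RG-vertex⇒IT S∈) (RG-vertex⇒IT T∈)
    where
    face-acyclic : ∀ I {k} → ∣ I ∣ ≡ suc k → ∀ {j} → j ≤ ∣ I ∣ → Acyclic (Face G class I) j
    face-acyclic I ∣I∣ j≤ = Acyclic-resp {P = Independent (induced G (⋃Class? I))} {Q = Face G class I}
      (λ (σ⊆V , ind) → ((λ v v∈ → proj₁ (σ⊆V v v∈)) ,
        λ u v u∈ v∈ u~v → ind u v u∈ v∈ (u~v , proj₂ (σ⊆V u u∈) , proj₂ (σ⊆V v v∈))) , λ v v∈ → proj₂ (σ⊆V v v∈))
      (λ ((σ⊆V , ind) , σ⊆) → (λ v v∈ → σ⊆V v v∈ , σ⊆ v v∈) , λ u v u∈ v∈ (u~v , _) → ind u v u∈ v∈ u~v)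
      (acyc I nonempty _ j≤)
      where
      nonempty : Nonempty I
      nonempty with nonempty? I
      ... | yes ne = ne
      ... | no ¬ne = contradiction (trans (sym ∣I∣) (trans (cong ∣_∣ (Empty-unique ¬ne)) (∣⊥∣≡0 n))) λ ()

    open Descent (Face G class) (Face-mono G class) (λ J ∣J∣ → face-acyclic J ∣J∣ (ℕ.≤-reflexive (sym ∣J∣)))
    open Reachability _≟ˢ_ RG-adjacent?

    section : ∀ {S} (it : IT G class S) → Section (image (choose G disjoint it))
    section it = record
      { face   = Face-image G disjoint it
      ; size   = ∣image∣ _ (choose-injective G disjoint it)
      ; facets = δ-image _ (choose-injective G disjoint it)
      }

    connect : ∀ {S T} → IT G class S → IT G class T → Star (Graph._~_ (RG (𝓘 G) 𝓥)) S T
    -- `A` is the indicator of the component of `S`. It is constant on transversals and equals 1 at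
    -- `S`, hence also at `T`.
    connect {S} {T} S-it T-it = via⇒Star (subsets N) (proj₂ (does-true (component? T) (begin
      A T      ≡⟨ value T-it ⟩
      κ       ≡⟨ value S-it ⟨
      A S      ≡⟨ dec-true (component? S) (S-it , via-refl (subsets N)) ⟩
      true     ∎)))
      where
      open ≡-Reasoning

      component? : Decidable (λ σ → IT G class σ × Via (subsets N) S σ)
      component? σ = IT? G class σ ×-dec via? (subsets N) S σ

      A : Cochain N
      A σ = does (component? σ)

      result = constant-on-sections A
        (λ τ (ind , τ⊆) ∣τ∣ → exchange-closed⇒cocycle G disjoint A (λ σ Aσ → proj₁ (does-true (component? σ) Aσ)) ind
          (λ v v∈τ _ → let (i , _ , v∈i) = τ⊆ v v∈τ in i , v∈i)
          -- The exchanged transversals are adjacent, so a component that contains one contains the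
          -- other.
          λ v w v∈τ w∈τ w≢v Av it-w → let (it-v , via) = does-true (component? _) Av in
            dec-true (component? _) (it-w , via-trans (subsets N) (∈-subsets _) via
              (via-step (subsets N) (exchange-adjacent ind ∣τ∣ v∈τ w≢v it-v it-w))))
        λ K i i∉K σ (_ , σ⊆) → dec-false (component? σ) λ (it , _) → IT-meets-every-class G disjoint i∉K σ⊆ it

      κ = proj₁ result

      value : ∀ {U} → IT G class U → A U ≡ κ
      value it = trans (cong A (sym (image-choose G disjoint it))) (proj₁ (proj₂ result) _ (section it))

-- Acyclicity from lower bounds on the domination numbers.

IsMinimum-lower : ∀ {P x a} → IsMinimum P x → [ a ] ≤∞ x → ∀ k → P k → a ≤ k
IsMinimum-lower (attained _ least) AddSup.[ a≤ℓ ] k pk = ℕ.≤-trans a≤ℓ (least k pk)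
IsMinimum-lower (vacuous none)     _ k pk              = contradiction pk (none k)

-- All vertices are taken as `Y`, with cost 2 per explosion: a dominating set has at least
-- `2 * k + 1` vertices, which exceeds `2 * j`.
γ̃⇒Acyclic : (H : FiniteGraph N) → ∀ k → [ 2 * k + 1 ] ≤∞ γ̃ H → ∀ j → j ≤ k → Acyclic (Independent H) j
γ̃⇒Acyclic {N} H k γ̃≥ j j≤k = undominated⇒Acyclic (allPairs N) H (vertex? H) (λ _ v∈ → v∈)
  (λ u v _ _ → ∈-allPairs u v) both-ends j λ X X⊆V dom → ℕ.≤-<-trans (ℕ.*-monoʳ-≤ 2 j≤k)
    (subst (_≤ ∣ X ∣) (ℕ.+-comm (2 * k) 1) (IsMinimum-lower (proj₂ (γ̃-minimum H)) γ̃≥ ∣ X ∣ (X , X⊆V , dom , refl)))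

dominated? : (H : FiniteGraph N) (k : ℕ) →
  Decidable λ S → ∃[ X ] VertexSet H X × StronglyDominates H X (_∈ S) × ∣ X ∣ ≤ k
dominated? H k S = anySubset? λ X → vertexSet? H X ×-dec stronglyDominates? H X (_∈? S) ×-dec (∣ X ∣ ℕ.≤? k)

-- As `iγ H` exceeds `k`, some independent set `S` is not dominated by any `k` or fewer vertices.
-- Taken as `Y`, it brings the cost of an explosion down to 1.
iγ⇒Acyclic : (H : FiniteGraph N) → ∀ k → [ k + 1 ] ≤∞ iγ H → ∀ j → j ≤ k → Acyclic (Independent H) j
iγ⇒Acyclic {N} H k iγ≥ j j≤k with anySubset? (λ S → independent? H S ×-dec ¬? (dominated? H k S))
... | yes (S , (S⊆V , ind) , ¬dom) = undominated⇒Acyclic (allPairs N) H (_∈? S) S⊆V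
  (λ u v _ _ → ∈-allPairs u v) (far-end ind) j λ X X⊆V dom →
    subst (_< ∣ X ∣) (sym (ℕ.*-identityˡ j)) (ℕ.≤-<-trans j≤k (ℕ.≰⇒> λ ∣X∣≤k → ¬dom (X , X⊆V , dom , ∣X∣≤k)))
-- Otherwise `k` itself bounds the domination of every independent set, so `iγ H` is at most `k`.
... | no ∄ = contradiction
  (subst (_≤ k) (ℕ.+-comm k 1) (IsMinimum-lower (proj₂ (iγ-minimum H)) iγ≥ k
    λ S ind → decidable-stable (dominated? H k S) λ ¬dom → ∄ (S , ind , ¬dom)))
  ℕ.1+n≰n

theorem6p2 : ∀ {N n : ℕ} (G : FiniteGraph N) (𝓥 : Partition (FiniteGraph.Vertex G) n) →
    let open Partition 𝓥 in
    ((∀ (I : Subset n) → Nonempty I → [ 2 * ∣ I ∣ + 1 ] ≤∞ γ̃ (induced G (⋃Class? I))) →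
    Connected (RG (𝓘 G) 𝓥))
    ×
    ((∀ (I : Subset n) → Nonempty I → [ ∣ I ∣ + 1 ] ≤∞ iγ (induced G (⋃Class? I))) →
    Connected (RG (𝓘 G) 𝓥))
theorem6p2 G 𝓥 =
  (λ γ̃≥ → acyclic⇒Connected G 𝓥 λ I I≢∅ → γ̃⇒Acyclic (induced G (⋃Class? I)) ∣ I ∣ (γ̃≥ I I≢∅)) ,
  (λ iγ≥ → acyclic⇒Connected G 𝓥 λ I I≢∅ → iγ⇒Acyclic (induced G (⋃Class? I)) ∣ I ∣ (iγ≥ I I≢∅))
  where open Partition 𝓥
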